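{- Let $G$ be a connected digraph, $X \subseteq V(G)$ connected and $L$ a list-assignment of $G$ such that $G-X$ is $L$-dicolourable, $G$ is not $L$-dicolourable and $\forall x \in X, \lvert L(x)\rvert \ge d_{\max}(x)$. Then $G[X]$ is a directed Gallai forest.
   Context: A list assignment of $G$ maps each vertex $v$ to a set $L(v)$ of colours; an $L$-dicolouring is an assignment $\phi(v)\in L(v)$ such that each colour class induces an acyclic subdigraph. $X$ connected means $G[X]$ is (weakly) connected. $d_{\max}(x)=\max(d^+(x),d^-(x))$ in $G$. A directed Gallai tree is a connected digraph whose blocks (maximal non-separable subdigraphs) are each a single arc, a directed cycle, a symmetric odd cycle, or a complete symmetric digraph; a directed Gallai forest is a digraph whose connected components are directed Gallai trees. -}

module Defs where

open import Data.Nat using (ℕ; zero; suc; _≤_; _⊔_; _*_)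
open import Data.Nat.DivMod using (_%_; m%n<n)
import Data.Nat.Properties as ℕP
open import Data.Fin using (Fin; toℕ; fromℕ<)
open import Data.Fin.Subset using (Subset; ∁; ⊤; _∈_; _⊆_; _-_; Nonempty; ∣_∣)
open import Data.Bool using (Bool; true; false)
open import Data.Vec using (tabulate)
open import Data.List using (List; length; deduplicate)
import Data.List.Membership.Propositional as LM
open import Data.Product using (Σ; ∃; ∃₂; _×_; _,_)
open import Data.Sum using (_⊎_)
open import Function.Definitions using (Injective)
open import Relation.Binary.PropositionalEquality using (_≡_; _≢_)
open import Relation.Nullary using (¬_)

record Digraph : Set where
  field
    n        : ℕ
    arc      : Fin n → Fin n → Bool
    loopless : ∀ v → arc v v ≡ false
open Digraph public

Arc : (G : Digraph) → Fin (n G) → Fin (n G) → Set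
Arc G u v = arc G u v ≡ true

Adj : (G : Digraph) → Fin (n G) → Fin (n G) → Set
Adj G u v = Arc G u v ⊎ Arc G v u

infix 3 _⇔_
_⇔_ : Set → Set → Set
A ⇔ B = (A → B) × (B → A)

outdeg indeg dmax : (G : Digraph) → Fin (n G) → ℕ
outdeg G x = ∣ tabulate (λ y → arc G x y) ∣
indeg  G x = ∣ tabulate (λ y → arc G y x) ∣
dmax   G x = outdeg G x ⊔ indeg G x

data Walk (G : Digraph) (S : Subset (n G)) : Fin (n G) → Fin (n G) → Set where
  here : ∀ {u} → u ∈ S → Walk G S u u
  step : ∀ {u v w} → u ∈ S → Adj G u v → Walk G S v w → Walk G S u w

-- G[S] is (weakly) connected (vacuously true for S empty; nonemptiness
-- is required separately where needed).
Connected : (G : Digraph) → Subset (n G) → Set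
Connected G S = ∀ u v → u ∈ S → v ∈ S → Walk G S u v

next : ∀ {m} → Fin (suc m) → Fin (suc m)
next {m} i = fromℕ< (m%n<n (suc (toℕ i)) (suc m))

-- A directed cycle of G (not necessarily induced) all of whose vertices
-- satisfy P: distinct vertices c 0, …, c m (m ≥ 1, i.e. length ≥ 2)
-- with arcs c i → c (i+1 mod (m+1)).
HasDirectedCycleIn : (G : Digraph) → (Fin (n G) → Set) → Set
HasDirectedCycleIn G P =
  ∃ λ m → 1 ≤ m × Σ (Fin (suc m) → Fin (n G)) λ c →
    Injective _≡_ _≡_ c × (∀ i → P (c i)) × (∀ i → Arc G (c i) (c (next i)))

∣_∣ₗ : List ℕ → ℕ
∣ l ∣ₗ = length (deduplicate ℕP._≟_ l)

Dicolourable : (G : Digraph) → Subset (n G) → (Fin (n G) → List ℕ) → Set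
Dicolourable G S L =
  Σ (Fin (n G) → ℕ) λ φ →
    (∀ v → v ∈ S → φ v LM.∈ L v) ×
    (∀ α → ¬ HasDirectedCycleIn G (λ v → v ∈ S × φ v ≡ α))

NonSeparable : (G : Digraph) → Subset (n G) → Set
NonSeparable G B = Connected G B × (∀ v → v ∈ B → Connected G (B - v))

-- B is (the vertex set of) a block of G[X]: a maximal non-separable
-- subdigraph (blocks are induced subdigraphs).
IsBlock : (G : Digraph) → Subset (n G) → Subset (n G) → Set
IsBlock G X B =
  B ⊆ X × Nonempty B × NonSeparable G B ×
  (∀ B′ → B ⊆ B′ → B′ ⊆ X → NonSeparable G B′ → B′ ⊆ B)

IsComponent : (G : Digraph) → Subset (n G) → Subset (n G) → Set
IsComponent G X C =
  C ⊆ X × Nonempty C × Connected G C ×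
  (∀ C′ → C ⊆ C′ → C′ ⊆ X → Connected G C′ → C′ ⊆ C)

Enumerates : (G : Digraph) → Subset (n G) → ∀ {k} → (Fin k → Fin (n G)) → Set
Enumerates G B c =
  Injective _≡_ _≡_ c × (∀ i → c i ∈ B) × (∀ w → w ∈ B → ∃ λ i → c i ≡ w)

IsSingleArc : (G : Digraph) → Subset (n G) → Set
IsSingleArc G B =
  ∃₂ λ u v → u ≢ v × (∀ w → (w ∈ B) ⇔ (w ≡ u ⊎ w ≡ v)) ×
    Arc G u v × arc G v u ≡ false

IsDirectedCycle : (G : Digraph) → Subset (n G) → Set
IsDirectedCycle G B =
  ∃ λ m → 1 ≤ m × Σ (Fin (suc m) → Fin (n G)) λ c →
    Enumerates G B c × (∀ i j → Arc G (c i) (c j) ⇔ (j ≡ next i))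

IsSymmetricOddCycle : (G : Digraph) → Subset (n G) → Set
IsSymmetricOddCycle G B =
  ∃ λ t → 1 ≤ t × Σ (Fin (suc (2 * t)) → Fin (n G)) λ c →
    Enumerates G B c ×
    (∀ i j → Arc G (c i) (c j) ⇔ (j ≡ next i ⊎ i ≡ next j))

IsCompleteSymmetric : (G : Digraph) → Subset (n G) → Set
IsCompleteSymmetric G B = ∀ u v → u ∈ B → v ∈ B → u ≢ v → Arc G u v

IsGallaiBlock : (G : Digraph) → Subset (n G) → Set
IsGallaiBlock G B =
  IsSingleArc G B ⊎ IsDirectedCycle G B ⊎
  IsSymmetricOddCycle G B ⊎ IsCompleteSymmetric G B

DirectedGallaiTree : (G : Digraph) → Subset (n G) → Set
DirectedGallaiTree G C =
  Nonempty C × Connected G C × (∀ B → IsBlock G C B → IsGallaiBlock G B)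

DirectedGallaiForest : (G : Digraph) → Subset (n G) → Set
DirectedGallaiForest G X = ∀ C → IsComponent G X C → DirectedGallaiTree G C

{-# OPTIONS --safe #-}
-- Consider dicolourings of G − x for x ∈ X, the hole. As the hole cannot be filled and
-- |L(x)| ≥ d_max(x), every colour of L(x) occurs exactly once among the out-neighbours of x
-- and exactly once among its in-neighbours, and no other colour occurs there. Hence the hole
-- may be shifted to any neighbour y ∈ X by giving x the colour of y. If S ⊆ X is
-- nonseparable, shifts inside S carry the colour of any w ∈ S − x to any neighbour of x in S;
-- therefore, if x has an out-neighbour in S, its out-neighbours in S show every colour used
-- on S − x, and likewise for in-neighbours.
--
-- On an induced cycle T this leaves two cases: if some vertex has two out-neighbours or two
-- in-neighbours in T, all arcs of T are symmetric and the colours alternate, so T is odd;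
-- otherwise T is a directed cycle. Let B ⊆ X be nonseparable with at least three vertices. It
-- contains an induced cycle, obtained from an edge by adding an ear. If S is a nonseparable
-- proper subset of B in which all in- and outdegrees are positive, an ear P of S in B brings
-- new colours, so every vertex of S has both in- and out-neighbours in P. Ears can be chosen
-- such that P has just two neighbours in S unless P is a single vertex; so P is a vertex
-- joined to all of S in both directions, and colouring around it shows that S is complete.
-- Iterating, B is complete.
module Submission where

open import Defs
open import Data.Bool using (Bool; true; false)
import Data.Bool.Properties as BoolP
open import Data.Fin using (Fin; zero; suc; toℕ; fromℕ; inject₁; opposite)
import Data.Fin.Properties as FinP
open import Data.Fin.Relation.Unary.Top using (view; ‵fromℕ; ‵inj₁)
open import Data.Fin.Subset as Sub using (Subset; ∁; ⊤; ⁅_⁆; _∈_; _∉_; _⊆_; _⊃_; _∪_; _-_; _─_; ∣_∣; Nonempty; outside; inside)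
open import Data.Fin.Subset.Induction using (⊃-wellFounded)
open import Data.Fin.Subset.Properties
open import Data.List using (List; []; _∷_; length; foldr; lookup)
import Data.List.Membership.Propositional as LM
open import Data.List.Membership.Propositional.Properties using (∈-deduplicate⁻; ∈-lookup)
open import Data.List.Relation.Unary.All as All using (All; []; _∷_)
open import Data.List.Relation.Unary.All.Properties using (¬Any⇒All¬)
open import Data.List.Relation.Unary.AllPairs using ([]; _∷_)
open import Data.List.Relation.Unary.Any as Any using (Any; here; there)
open import Data.List.Relation.Unary.Any.Properties using (lookup-index)
open import Data.List.Relation.Unary.Unique.Propositional using (Unique)
open import Data.Nat using (ℕ; zero; suc; _≤_; _<_; z≤n; s≤s; _*_)
open import Data.Nat.DivMod using (_%_; m<n⇒m%n≡m; n%n≡0)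
import Data.Nat.Properties as ℕP
open import Data.Product using (∃; ∃₂; _×_; _,_; proj₁; proj₂)
open import Data.Sum as Sum using (_⊎_; inj₁; inj₂; swap; [_,_]′)
open import Data.Vec as Vec using (tabulate; _∷_)
open import Data.Vec.Functional using (updateAt)
open import Data.Vec.Functional.Properties using (updateAt-updates; updateAt-minimal)
open import Data.Vec.Properties using (lookup∘tabulate; lookup⇒[]=; []=⇒lookup)
open import Function using (_∘_; const; case_of_; id)
open import Function.Definitions using (Injective)
open import Induction.WellFounded using (Acc; acc)
open import Relation.Binary.PropositionalEquality
open import Relation.Nullary
open import Relation.Unary using (Decidable)
open import Data.List.Relation.Unary.Unique.DecPropositional.Properties ℕP._≟_ using (deduplicate-!)

-- Subsets of a finite set.

private
  variable
    k : ℕ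

x∈p─q⇒x∉q : ∀ {x : Fin k} (p q : Subset k) → x ∈ p ─ q → x ∉ q
x∈p─q⇒x∉q (_ ∷ p) (outside ∷ q) (Vec.there x∈) (Vec.there x∈q) = x∈p─q⇒x∉q p q x∈ x∈q
x∈p─q⇒x∉q (_ ∷ p) (inside ∷ q) (Vec.there x∈) (Vec.there x∈q) = x∈p─q⇒x∉q p q x∈ x∈q

x∈p-y⇒x∈p : ∀ {x} (p : Subset k) y → x ∈ p - y → x ∈ p
x∈p-y⇒x∈p p y = p─q⊆p p ⁅ y ⁆

x∈p-y⇒x≢y : ∀ {x} (p : Subset k) y → x ∈ p - y → x ≢ y
x∈p-y⇒x≢y p y x∈ refl = x∈p─q⇒x∉q p ⁅ y ⁆ x∈ (x∈⁅x⁆ y)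

∈∧∉⇒≢ : ∀ {x y} {p : Subset k} → x ∈ p → y ∉ p → x ≢ y
∈∧∉⇒≢ x∈ y∉ refl = y∉ x∈

x∈⊤-y : ∀ {x y : Fin k} → x ≢ y → x ∈ ⊤ - y
x∈⊤-y = x∈p∧x≢y⇒x∈p-y ∈⊤

⊆-or-∉ : (p q : Subset k) → p ⊆ q ⊎ ∃ λ x → x ∈ p × x ∉ q
⊆-or-∉ p q with FinP.any? (λ x → (x ∈? p) ×-dec ¬? (x ∈? q))
... | yes w = inj₂ w
... | no ¬w = inj₁ λ {x} x∈p → decidable-stable (x ∈? q) (λ x∉q → ¬w (x , x∈p , x∉q))

-- The cyclic successor and positions on a cycle.

next-inject₁ : ∀ (i : Fin k) → next (inject₁ i) ≡ suc i
next-inject₁ {k} i = FinP.toℕ-injective (begin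
  toℕ (next (inject₁ i))        ≡⟨ FinP.toℕ-fromℕ< _ ⟩
  suc (toℕ (inject₁ i)) % suc k ≡⟨ cong (λ z → suc z % suc k) (FinP.toℕ-inject₁ i) ⟩
  suc (toℕ i) % suc k           ≡⟨ m<n⇒m%n≡m (s≤s (FinP.toℕ<n i)) ⟩
  suc (toℕ i)                   ∎)
  where
    open ≡-Reasoning

next-fromℕ : ∀ k → next (fromℕ k) ≡ zero
next-fromℕ k = FinP.toℕ-injective (begin
  toℕ (next (fromℕ k))          ≡⟨ FinP.toℕ-fromℕ< _ ⟩
  suc (toℕ (fromℕ k)) % suc k   ≡⟨ cong (λ z → suc z % suc k) (FinP.toℕ-fromℕ k) ⟩
  suc k % suc k                 ≡⟨ n%n≡0 (suc k) ⟩
  0                             ∎)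
  where
    open ≡-Reasoning

next-surjective : ∀ (i : Fin (suc k)) → ∃ λ j → next j ≡ i
next-surjective zero    = fromℕ _ , next-fromℕ _
next-surjective (suc i) = inject₁ i , next-inject₁ i

next-injective : ∀ {i j : Fin (suc k)} → next i ≡ next j → i ≡ j
next-injective {i = i} {j} eq with view i | view j
... | ‵fromℕ | ‵fromℕ = refl
... | ‵fromℕ | ‵inj₁ {i = j} _ =
  case trans (sym (next-fromℕ _)) (trans eq (next-inject₁ j)) of λ ()
... | ‵inj₁ {i = i} _ | ‵fromℕ =
  case trans (sym (next-inject₁ i)) (trans eq (next-fromℕ _)) of λ ()
... | ‵inj₁ {i = i} _ | ‵inj₁ {i = j} _ = cong inject₁
  (FinP.suc-injective (trans (sym (next-inject₁ i)) (trans eq (next-inject₁ j))))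

toℕ-next : ∀ (i : Fin (suc k)) → toℕ i < k → toℕ (next i) ≡ suc (toℕ i)
toℕ-next i i<k with view i
... | ‵fromℕ = contradiction i<k (ℕP.≤⇒≯ (ℕP.≤-reflexive (sym (FinP.toℕ-fromℕ _))))
... | ‵inj₁ {i = i} _ = trans (cong toℕ (next-inject₁ i)) (cong suc (sym (FinP.toℕ-inject₁ i)))

infix 4 _⋖_
-- Successor without wrap-around: the order along a path, whereas `next` is the order around a
-- cycle.
_⋖_ : Fin (suc k) → Fin (suc k) → Set
i ⋖ j = ∃ λ l → i ≡ inject₁ l × j ≡ suc l

suc-⋖ : ∀ {i j : Fin (suc k)} → i ⋖ j → suc i ⋖ suc j
suc-⋖ (l , i≡ , j≡) = suc l , cong suc i≡ , cong suc j≡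

⋖⇒next : ∀ {i j : Fin (suc k)} → i ⋖ j → j ≡ next i
⋖⇒next (l , refl , refl) = sym (next-inject₁ l)

opposite-inject₁ : ∀ (i : Fin k) → opposite (inject₁ i) ≡ suc (opposite i)
opposite-inject₁ zero    = refl
opposite-inject₁ (suc i) = cong inject₁ (opposite-inject₁ i)

opposite-fromℕ : ∀ k → opposite (fromℕ k) ≡ zero
opposite-fromℕ zero    = refl
opposite-fromℕ (suc k) = cong inject₁ (opposite-fromℕ k)

-- `opposite` reverses the cyclic order, wrap-around included; this allows a cycle to be enumerated
-- backwards.
next-opposite-next : ∀ (i : Fin (suc k)) → next (opposite (next i)) ≡ opposite i
next-opposite-next {k} i with view i
... | ‵fromℕ = begin
  next (opposite (next (fromℕ k))) ≡⟨ cong (next ∘ opposite) (next-fromℕ k) ⟩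
  next (fromℕ k)                   ≡⟨ next-fromℕ k ⟩
  zero                             ≡⟨ opposite-fromℕ k ⟨
  opposite (fromℕ k)               ∎
  where open ≡-Reasoning
... | ‵inj₁ {i = j} _ = begin
  next (opposite (next (inject₁ j))) ≡⟨ cong (next ∘ opposite) (next-inject₁ j) ⟩
  next (inject₁ (opposite j))        ≡⟨ next-inject₁ (opposite j) ⟩
  suc (opposite j)                   ≡⟨ opposite-inject₁ j ⟨
  opposite (inject₁ j)               ∎
  where open ≡-Reasoning

-- Positions indexed by natural numbers, so that inductions can run around the cycle and return to
-- `zero`.
turn : ℕ → Fin (suc k)
turn zero    = zero
turn (suc t) = next (turn t)

toℕ-turn : ∀ t → t ≤ k → toℕ (turn {k} t) ≡ t
toℕ-turn zero    _   = refl
toℕ-turn {k} (suc t) t<k =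
  trans (toℕ-next (turn t) (subst (_< k) (sym ih) t<k)) (cong suc ih)
  where
  ih : toℕ (turn t) ≡ t
  ih = toℕ-turn t (ℕP.<⇒≤ t<k)

turn-toℕ : ∀ (i : Fin (suc k)) → turn (toℕ i) ≡ i
turn-toℕ i = FinP.toℕ-injective (toℕ-turn (toℕ i) (FinP.toℕ≤pred[n] i))

turn-full : ∀ k → turn {k} (suc k) ≡ zero
turn-full k = trans (cong next (FinP.toℕ-injective
  (trans (toℕ-turn k ℕP.≤-refl) (sym (FinP.toℕ-fromℕ k))))) (next-fromℕ k)

turn-≢ : ∀ {s t} → s < t → t ≤ k → turn {k} s ≢ turn t
turn-≢ s<t t≤k eq = ℕP.<⇒≢ s<t
  (trans (sym (toℕ-turn _ (ℕP.≤-trans (ℕP.<⇒≤ s<t) t≤k))) (trans (cong toℕ eq) (toℕ-turn _ t≤k)))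

-- On a cycle of length at least three, the two neighbours of a position are different.
next²-≢ : 2 ≤ k → ∀ (i : Fin (suc k)) → next (next i) ≢ i
next²-≢ 2≤k i eq with view i
next²-≢ {suc k} (s≤s 1≤k) i eq | ‵fromℕ =
  case trans (sym (next-inject₁ {suc k} zero)) (trans (cong next (sym (next-fromℕ (suc k)))) eq) of
    one≢last 1≤k
  where
  one≢last : ∀ {k} → 1 ≤ k → suc zero ≢ fromℕ (suc k)
  one≢last {suc k} _ ()
next²-≢ {suc k} (s≤s 1≤k) i eq | ‵inj₁ {i = j} _ with view j
... | ‵fromℕ = case trans (sym (next-fromℕ (suc k)))
                 (trans (cong next (sym (next-inject₁ (fromℕ k)))) eq) of zero≢ 1≤k
  where
  zero≢ : ∀ {k} → 1 ≤ k → zero ≢ inject₁ (fromℕ k)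
  zero≢ {suc k} _ ()
... | ‵inj₁ {i = l} _ = suc²≢ l (trans (sym (next-inject₁ (suc l)))
                 (trans (cong next (sym (next-inject₁ (inject₁ l)))) eq))
  where
  suc²≢ : ∀ {k} (l : Fin k) → suc (suc l) ≢ inject₁ (inject₁ l)
  suc²≢ (suc l) eq = suc²≢ l (FinP.suc-injective eq)

-- Parity, directions and counting.

-- The number 2t + 1, by a recursion that matches moving the hole two positions at a time.
odd : ℕ → ℕ
odd zero    = 1
odd (suc t) = suc (suc (odd t))

parity : ∀ m → (∃ λ t → m ≡ 2 * t) ⊎ (∃ λ t → m ≡ odd t)
parity zero          = inj₁ (0 , refl)
parity (suc zero)    = inj₂ (0 , refl)
parity (suc (suc m)) with parity m
... | inj₁ (t , refl) = inj₁ (suc t , sym (ℕP.*-suc 2 t))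
... | inj₂ (t , refl) = inj₂ (suc t , refl)

1≤odd : ∀ t → 1 ≤ odd t
1≤odd zero    = s≤s z≤n
1≤odd (suc t) = s≤s z≤n

-- Out- and in-neighbours obey mirror-image statements; with a direction as parameter each is proved
-- once.
data Direction : Set where
  fwd bwd : Direction

flip : Direction → Direction
flip fwd = bwd
flip bwd = fwd

flip-flip : ∀ d → flip (flip d) ≡ d
flip-flip fwd = refl
flip-flip bwd = refl

-- Removing from `p` a preimage of the first value loses no preimage of the others, as the values
-- are distinct.
pigeonhole : ∀ {A : Set} {f : Fin k → A} {ks : List A} (p : Subset k) → Unique ks →
  (∀ {c} → c LM.∈ ks → ∃ λ u → u ∈ p × f u ≡ c) → length ks ≤ ∣ p ∣
pigeonhole p [] hit = z≤n
pigeonhole {f = f} p (c∉ ∷ uniq) hit with hit (here refl)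
... | u , u∈p , refl =
  ℕP.≤-<-trans
    (pigeonhole {f = f} (p - u) uniq λ c∈ → let (v , v∈p , eq) = hit (there c∈) in
       v , x∈p∧x≢y⇒x∈p-y v∈p (λ v≡u → All.lookup c∉ c∈ (trans (cong f (sym v≡u)) eq)) , eq)
    (x∈p⇒∣p-x∣<∣p∣ u∈p)

-- Neighbourhoods and walks.

module Walks (G : Digraph) where

  V : Set
  V = Fin (n G)

  private
    variable
      x y u v w : V
      S T : Subset (n G)

  arcs : Direction → V → V → Bool
  arcs fwd u v = arc G u v
  arcs bwd u v = arc G v u

  N : Direction → V → Subset (n G)
  N d x = tabulate (arcs d x)

  ∈N⁺ : ∀ d → arcs d x y ≡ true → y ∈ N d x
  ∈N⁺ {x} {y} d eq = lookup⇒[]= y (N d x) (trans (lookup∘tabulate (arcs d x) y) eq)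

  ∈N⁻ : ∀ d → y ∈ N d x → arcs d x y ≡ true
  ∈N⁻ {y} {x} d y∈ = trans (sym (lookup∘tabulate (arcs d x) y)) ([]=⇒lookup y∈)

  arcs-flip : ∀ d u v → arcs (flip d) u v ≡ arcs d v u
  arcs-flip fwd u v = refl
  arcs-flip bwd u v = refl

  ∈N-flip : ∀ d → y ∈ N d x → x ∈ N (flip d) y
  ∈N-flip {y} {x} d y∈ = ∈N⁺ (flip d) (trans (arcs-flip d y x) (∈N⁻ d y∈))

  x∉Nx : ∀ d → x ∉ N d x
  x∉Nx {x} fwd x∈ = case trans (sym (loopless G x)) (∈N⁻ fwd x∈) of λ ()
  x∉Nx {x} bwd x∈ = case trans (sym (loopless G x)) (∈N⁻ bwd x∈) of λ ()

  N⇒≢ : ∀ d → y ∈ N d x → y ≢ x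
  N⇒≢ d y∈ refl = x∉Nx d y∈

  N⇒Adj : ∀ d → y ∈ N d x → Adj G x y
  N⇒Adj fwd y∈ = inj₁ (∈N⁻ fwd y∈)
  N⇒Adj bwd y∈ = inj₂ (∈N⁻ bwd y∈)

  Adj⇒N : Adj G x y → ∃ λ d → y ∈ N d x
  Adj⇒N (inj₁ a) = fwd , ∈N⁺ fwd a
  Adj⇒N (inj₂ a) = bwd , ∈N⁺ bwd a

  Adj-sym : Adj G x y → Adj G y x
  Adj-sym = swap

  Adj-irrefl : Adj G x y → x ≢ y
  Adj-irrefl a refl = let (d , x∈) = Adj⇒N a in x∉Nx d x∈

  Adj? : ∀ x y → Dec (Adj G x y)
  Adj? x y = (arc G x y BoolP.≟ true) ⊎-dec (arc G y x BoolP.≟ true)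

  degree≤dmax : ∀ d x → ∣ N d x ∣ ≤ dmax G x
  degree≤dmax fwd x = ℕP.m≤m⊔n (outdeg G x) (indeg G x)
  degree≤dmax bwd x = ℕP.m≤n⊔m (outdeg G x) (indeg G x)

  walk-start : Walk G S u v → u ∈ S
  walk-start (here u∈) = u∈
  walk-start (step u∈ _ _) = u∈

  walk-end : Walk G S u v → v ∈ S
  walk-end (here u∈) = u∈
  walk-end (step _ _ ω) = walk-end ω

  walk-mono : S ⊆ T → Walk G S u v → Walk G T u v
  walk-mono S⊆T (here u∈) = here (S⊆T u∈)
  walk-mono S⊆T (step u∈ a ω) = step (S⊆T u∈) a (walk-mono S⊆T ω)

  walk-trans : Walk G S u v → Walk G S v w → Walk G S u w
  walk-trans (here _) ω′ = ω′
  walk-trans (step u∈ a ω) ω′ = step u∈ a (walk-trans ω ω′)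

  walk-sym : Walk G S u v → Walk G S v u
  walk-sym (here u∈) = here u∈
  walk-sym (step u∈ a ω) =
    walk-trans (walk-sym ω) (step (walk-start ω) (Adj-sym a) (here u∈))

  connected-via : ∀ r → (∀ {w} → w ∈ S → Walk G S w r) → Connected G S
  connected-via r to u v u∈ v∈ = walk-trans (to u∈) (walk-sym (to v∈))

  first-step : u ≢ v → Walk G S u v → ∃ λ w → w ∈ S × Adj G u w
  first-step u≢v (here _) = contradiction refl u≢v
  first-step u≢v (step _ a ω) = _ , walk-start ω , a

  exit : u ∈ S → v ∉ S → Walk G T u v → ∃₂ λ a p → a ∈ S × p ∈ T × p ∉ S × Adj G a p
  exit u∈ v∉ (here _) = contradiction u∈ v∉
  exit {S = S} u∈ v∉ (step {v = p} _ a ω) with p ∈? S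
  ... | yes p∈ = exit p∈ v∉ ω
  ... | no p∉  = _ , p , u∈ , walk-start ω , p∉ , a

-- Extending and restricting dicolourings.

module Colouring (G : Digraph) (L : Fin (n G) → List ℕ) where

  open Walks G

  private
    variable
      x y u v w : V
      S T : Subset (n G)
      φ : V → ℕ

  infixl 6 _[_≔_]
  _[_≔_] : (V → ℕ) → V → ℕ → V → ℕ
  φ [ x ≔ c ] = updateAt φ x (const c)

  IsDicolouring : Subset (n G) → (V → ℕ) → Set
  IsDicolouring S φ =
    (∀ v → v ∈ S → φ v LM.∈ L v) ×
    (∀ α → ¬ HasDirectedCycleIn G (λ v → v ∈ S × φ v ≡ α))

  cycle-neighbour : ∀ {m} (c : Fin (suc m) → V) → (∀ i → Arc G (c i) (c (next i))) →
    ∀ d i → ∃ λ j → c j ∈ N d (c i)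
  cycle-neighbour c arcs′ fwd i = next i , ∈N⁺ fwd (arcs′ i)
  cycle-neighbour c arcs′ bwd i with next-surjective i
  ... | j , refl = j , ∈N⁺ bwd (arcs′ j)

  -- A directed cycle through `x` contains both an out-neighbour and an in-neighbour of `x`, so it
  -- is enough that `c` is absent on one side. Cycles avoiding `x` keep their old colours.
  extend : ∀ d x {c} → IsDicolouring S φ → c LM.∈ L x →
    (∀ {u} → u ∈ N d x → u ∈ S → φ u ≢ c) →
    (∀ {v} → v ∈ T → v ≢ x → v ∈ S) → IsDicolouring T (φ [ x ≔ c ])
  extend {S} {φ} {T} d x {c} (inL , acyclic) c∈ free T⊆ = inL′ , acyclic′
    where
    other : ∀ {v} → v ≢ x → (φ [ x ≔ c ]) v ≡ φ v
    other v≢x = updateAt-minimal _ _ φ v≢x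

    inL′ : ∀ v → v ∈ T → (φ [ x ≔ c ]) v LM.∈ L v
    inL′ v v∈ with v FinP.≟ x
    ... | yes refl = subst (LM._∈ L v) (sym (updateAt-updates v φ)) c∈
    ... | no v≢x   = subst (LM._∈ L v) (sym (other v≢x)) (inL v (T⊆ v∈ v≢x))

    acyclic′ : ∀ α → ¬ HasDirectedCycleIn G (λ v → v ∈ T × (φ [ x ≔ c ]) v ≡ α)
    acyclic′ α (m , 1≤m , γ , inj , mono , arcs′) with FinP.any? (λ i → γ i FinP.≟ x)
    ... | yes (i , refl) =
      let (j , γj∈) = cycle-neighbour γ arcs′ d i
          γj≢x = λ eq → x∉Nx d (subst (_∈ N d x) eq γj∈)
      in free γj∈ (T⊆ (proj₁ (mono j)) γj≢x)
           (trans (sym (other γj≢x))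
             (trans (proj₂ (mono j)) (trans (sym (proj₂ (mono i))) (updateAt-updates x φ))))
    ... | no avoids =
      acyclic α (m , 1≤m , γ , inj ,
        (λ i → let γi≢x = λ eq → avoids (i , eq) in
          T⊆ (proj₁ (mono i)) γi≢x , trans (sym (other γi≢x)) (proj₂ (mono i))) , arcs′)

  restrict : (∀ {v} → v ∈ T → v ∈ S) → IsDicolouring S φ → IsDicolouring T φ
  restrict T⊆S (inL , acyclic) =
    (λ v v∈ → inL v (T⊆S v∈)) ,
    λ α (m , 1≤m , γ , inj , mono , arcs′) →
      acyclic α (m , 1≤m , γ , inj , (λ i → T⊆S (proj₁ (mono i)) , proj₂ (mono i)) , arcs′)

  -- The value φ x at the hole x is junk.
  Hole : V → (V → ℕ) → Set
  Hole x φ = IsDicolouring (⊤ - x) φ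

  -- Colours around a hole, and moving the hole.

  module Holes (X : Subset (n G)) (uncolourable : ¬ Dicolourable G ⊤ L)
    (bound : ∀ x → x ∈ X → dmax G x ≤ ∣ L x ∣ₗ) where

    abstract

      -- Without `u` there are fewer than d_max(x) neighbours on side `d`, hence too few to show all
      -- of `L x`.
      free-colour : ∀ d → x ∈ X → u ∈ N d x → (φ : V → ℕ) →
        ∃ λ c → c LM.∈ L x × (∀ {v} → v ∈ N d x → v ≢ u → φ v ≢ c)
      free-colour {x} {u} d x∈X u∈ φ with Any.any? (λ c → ¬? (used? c)) (L x)
        where
        used? : ∀ c → Dec (∃ λ v → v ∈ N d x - u × φ v ≡ c)
        used? c = FinP.any? λ v → (v ∈? (N d x - u)) ×-dec (φ v ℕP.≟ c)
      ... | yes some =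
        let (c , c∈ , unused) = LM.find some in
        c , c∈ , λ v∈ v≢u eq → unused (_ , x∈p∧x≢y⇒x∈p-y v∈ v≢u , eq)
      ... | no none = contradiction
        (ℕP.≤-trans (degree≤dmax d x) (bound x x∈X))
        (ℕP.<⇒≱ (ℕP.≤-<-trans
          (pigeonhole {f = φ} (N d x - u) (deduplicate-! (L x)) λ {c} c∈ →
            decidable-stable (FinP.any? λ v → (v ∈? (N d x - u)) ×-dec (φ v ℕP.≟ c))
              (λ ¬used → none (LM.lose (∈-deduplicate⁻ ℕP._≟_ (L x) c∈) ¬used)))
          (x∈p⇒∣p-x∣<∣p∣ u∈)))

      -- A colour of `L x` missing on one side could be given to `x`, and `G` would be dicoloured.
      palette-seen : ∀ d → Hole x φ → ∀ {c} → c LM.∈ L x → ∃ λ u → u ∈ N d x × φ u ≡ c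
      palette-seen {x} {φ} d h {c} c∈
        with FinP.any? (λ u → (u ∈? N d x) ×-dec (φ u ℕP.≟ c))
      ... | yes seen = seen
      ... | no ¬seen = contradiction
        (φ [ x ≔ c ] , extend d x h c∈ (λ u∈ _ eq → ¬seen (_ , u∈ , eq)) (λ _ → x∈⊤-y))
        uncolourable

      -- Some colour of `L x` is absent once `u` is ignored, yet it must be seen; so only `u` shows
      -- it. Then no other `v` on that side shares the colour of `u`.
      rainbow : ∀ d → x ∈ X → Hole x φ → u ∈ N d x → v ∈ N d x → φ u ≡ φ v → u ≡ v
      rainbow {φ = φ} {u} {v} d x∈X h u∈ v∈ φu≡φv with u FinP.≟ v
      ... | yes u≡v = u≡v
      ... | no u≢v with free-colour d x∈X u∈ φ
      ... | c , c∈ , free with palette-seen d h c∈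
      ... | w , w∈ , refl with w FinP.≟ u
      ... | yes refl = contradiction (sym φu≡φv) (free v∈ (u≢v ∘ sym))
      ... | no w≢u = contradiction refl (free w∈ w≢u)

      -- The colour of `L x` that is absent once `u` is ignored must be seen, so it is the colour of
      -- `u`.
      neighbour-colour∈L : ∀ d → x ∈ X → Hole x φ → u ∈ N d x → φ u LM.∈ L x
      neighbour-colour∈L {φ = φ} {u} d x∈X h u∈ with free-colour d x∈X u∈ φ
      ... | c , c∈ , free with palette-seen d h c∈
      ... | w , w∈ , refl with w FinP.≟ u
      ... | yes refl = c∈
      ... | no w≢u = contradiction refl (free w∈ w≢u)

      -- On the side where `y` lies, no other vertex has the colour of `y`; once `y` is uncoloured,
      -- `x` can take it.
      shift : x ∈ X → Adj G x y → Hole x φ → Hole y (φ [ x ≔ φ y ])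
      shift {x} {y} x∈X a h with Adj⇒N a
      ... | d , y∈ = extend {S = ⊤ - x - y} d x
        (restrict (x∈p-y⇒x∈p (⊤ - x) y) h)
        (neighbour-colour∈L d x∈X h y∈)
        (λ {u} u∈ u∈S eq → x∈p-y⇒x≢y (⊤ - x) y u∈S (rainbow d x∈X h u∈ y∈ eq))
        (λ v∈ v≢x → x∈p∧x≢y⇒x∈p-y (x∈⊤-y v≢x) (x∈p-y⇒x≢y ⊤ y v∈))

      -- A set `T` grows from `x` to all of `X` through adjacent vertices, and colours are given in
      -- the reverse order. The continuation `finish` turns a dicolouring outside `T` into one with
      -- hole `x`.
      hole-exists : Connected G X → Dicolourable G (∁ X) L → x ∈ X → ∃ (Hole x)
      hole-exists {x} connX (φ₀ , d₀) x∈X =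
        peel ⁅ x ⁆ (⊃-wellFounded ⁅ x ⁆) (x∈⁅x⁆ x)
          (λ (φ , h) → φ , restrict (λ v∈ → x∉p⇒x∈∁p (λ v∈x →
             x∈p-y⇒x≢y ⊤ x v∈ (x∈⁅y⁆⇒x≡y x v∈x))) h)
        where
        peel : ∀ T → Acc _⊃_ T → x ∈ T → (∃ (IsDicolouring (∁ T)) → ∃ (Hole x)) → ∃ (Hole x)
        peel T (acc rec) x∈T finish with ⊆-or-∉ X T
        ... | inj₁ X⊆T = finish (φ₀ , restrict (λ v∈ → x∉p⇒x∈∁p (x∈∁p⇒x∉p v∈ ∘ X⊆T)) d₀)
        ... | inj₂ (y , y∈X , y∉T) with exit x∈T y∉T (connX x y x∈X y∈X)
        ... | t , p , t∈T , p∈X , p∉T , adj with Adj⇒N (Adj-sym adj)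
        ... | d , t∈N =
          peel (T ∪ ⁅ p ⁆)
            (rec (p⊆p∪q ⁅ p ⁆ , p , x∈p∪q⁺ (inj₂ (x∈⁅x⁆ p)) , p∉T))
            (x∈p∪q⁺ (inj₁ x∈T))
            (λ (φ , h) →
              -- The neighbour `t` of `p` lies in `T` and is still uncoloured, so it may be ignored.
              let (c , c∈ , free) = free-colour d p∈X t∈N φ in
              finish (φ [ p ≔ c ] ,
                extend d p h c∈
                  (λ u∈ u∉ → free u∈ (λ where refl → x∈∁p⇒x∉p u∉ (x∈p∪q⁺ (inj₁ t∈T))))
                  (λ v∉ v≢p → x∉p⇒x∈∁p λ v∈ → case x∈p∪q⁻ T ⁅ p ⁆ v∈ of λ where
                    (inj₁ v∈T) → x∈∁p⇒x∉p v∉ v∈T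
                    (inj₂ v∈p) → v≢p (x∈⁅y⁆⇒x≡y p v∈p))))

    -- The outcome of moving the hole from `x` to `y` within `S`. The field `recolour` says that
    -- tokens are only permuted inside `S`: no new colour enters.
    record Moved (S : Subset (n G)) (x : V) (φ : V → ℕ) (y : V) : Set where
      constructor moved
      field
        colouring : V → ℕ
        hole     : Hole y colouring
        outside= : ∀ {v} → v ∉ S → colouring v ≡ φ v
        recolour : ∀ {v} → v ∈ S → v ≢ y → ∃ λ u → u ∈ S × u ≢ x × φ u ≡ colouring v

    abstract

      shift-in : S ⊆ X → x ∈ S → y ∈ S → Adj G x y → Hole x φ → Moved S x φ y
      shift-in {S} {x} {y} {φ} S⊆X x∈ y∈ a h = moved (φ [ x ≔ φ y ]) (shift (S⊆X x∈) a h)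
        (λ v∉ → updateAt-minimal _ _ φ (∈∧∉⇒≢ x∈ v∉ ∘ sym))
        recolour
        where
        recolour : ∀ {v} → v ∈ S → v ≢ y → ∃ λ u → u ∈ S × u ≢ x × φ u ≡ (φ [ x ≔ φ y ]) v
        recolour {v} v∈ v≢y with v FinP.≟ x
        ... | yes refl = y , y∈ , Adj-irrefl a ∘ sym , sym (updateAt-updates v φ)
        ... | no v≢x   = v , v∈ , v≢x , sym (updateAt-minimal _ _ φ v≢x)

      move : S ⊆ X → Walk G S x y → Hole x φ → Moved S x φ y
      move S⊆X (here x∈) h = moved _ h (λ _ → refl) (λ v∈ v≢ → _ , v∈ , v≢ , refl)
      move S⊆X (step x∈ a ω) h with shift-in S⊆X x∈ (walk-start ω) a h
      ... | moved φ′ h′ out′ re′ with move S⊆X ω h′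
      ... | moved ψ h″ out″ re″ = moved ψ h″ (λ v∉ → trans (out″ v∉) (out′ v∉)) λ v∈ v≢ →
        let (u , u∈ , u≢ , eq) = re″ v∈ v≢
            (t , t∈ , t≢ , eq′) = re′ u∈ u≢
        in t , t∈ , t≢ , trans eq′ eq

      -- The hole goes from `x` to `v` avoiding `w`, changes places with the token of `w`, and
      -- returns from `w` to `x` avoiding `v`. Nonseparability supplies both walks.
      carry : S ⊆ X → NonSeparable G S → x ∈ S → w ∈ S → w ≢ x → v ∈ S → v ≢ x → Adj G w v →
        Hole x φ → ∃ λ ψ → Hole x ψ × ψ v ≡ φ w × (∀ {u} → u ∉ S → ψ u ≡ φ u)
      carry {S} {x} {w} {v} S⊆X (_ , cut) x∈ w∈ w≢x v∈ v≢x a h =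
        let moved φ₁ h₁ out₁ _ = move (S⊆X ∘ x∈p-y⇒x∈p S w)
              (cut w w∈ x v (x∈p∧x≢y⇒x∈p-y x∈ (w≢x ∘ sym))
                            (x∈p∧x≢y⇒x∈p-y v∈ (Adj-irrefl a ∘ sym))) h
            h₂ = shift (S⊆X v∈) (Adj-sym a) h₁
            moved φ₃ h₃ out₃ _ = move (S⊆X ∘ x∈p-y⇒x∈p S v)
              (cut v v∈ w x (x∈p∧x≢y⇒x∈p-y w∈ (Adj-irrefl a))
                            (x∈p∧x≢y⇒x∈p-y x∈ (v≢x ∘ sym))) h₂
        in φ₃ , h₃ ,
          trans (out₃ (λ v∈ → x∈p-y⇒x≢y S v v∈ refl))
            (trans (updateAt-updates v φ₁) (out₁ (λ w∈ → x∈p-y⇒x≢y S w w∈ refl))) ,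
          λ u∉ → trans (out₃ (u∉ ∘ x∈p-y⇒x∈p S v))
            (trans (updateAt-minimal _ _ φ₁ (∈∧∉⇒≢ v∈ u∉ ∘ sym)) (out₁ (u∉ ∘ x∈p-y⇒x∈p S w)))

      carry-along : S ⊆ X → NonSeparable G S → x ∈ S → Walk G (S - x) w v →
        Hole x φ → ∃ λ ψ → Hole x ψ × ψ v ≡ φ w × (∀ {u} → u ∉ S → ψ u ≡ φ u)
      carry-along S⊆X ns x∈ (here _) h = _ , h , refl , λ _ → refl
      carry-along {S} {x} S⊆X ns x∈ (step w∈ a ω) h =
        let (φ₁ , h₁ , eq₁ , out₁) = carry S⊆X ns x∈ (x∈p-y⇒x∈p S x w∈) (x∈p-y⇒x≢y S x w∈)
              (x∈p-y⇒x∈p S x (walk-start ω)) (x∈p-y⇒x≢y S x (walk-start ω)) a h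
            (ψ , h₂ , eq₂ , out₂) = carry-along S⊆X ns x∈ ω h₁
        in ψ , h₂ , trans eq₂ eq₁ , λ u∉ → trans (out₂ u∉) (out₁ u∉)

      -- A token of colour φ w can be carried to u, so φ w lies in L x and must be seen by
      -- N d x; it cannot be seen outside S, where nothing has moved.
      colours-seen : ∀ d → S ⊆ X → NonSeparable G S → x ∈ S → Hole x φ →
        u ∈ N d x → u ∈ S → w ∈ S → w ≢ x → ∃ λ v → v ∈ N d x × v ∈ S × φ v ≡ φ w
      colours-seen {S} {x} {φ} {u} {w} d S⊆X ns x∈ h u∈N u∈ w∈ w≢x =
        let (ψ , hψ , ψu≡φw , out) = carry-along S⊆X ns x∈
              (proj₂ ns x x∈ w u (x∈p∧x≢y⇒x∈p-y w∈ w≢x)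
                (x∈p∧x≢y⇒x∈p-y u∈ (N⇒≢ d u∈N))) h
            (v , v∈N , φv≡φw) =
              palette-seen d h (subst (LM._∈ L x) ψu≡φw (neighbour-colour∈L d (S⊆X x∈) hψ u∈N))
            v≡u = λ v∉ → rainbow d (S⊆X x∈) hψ v∈N u∈N
              (trans (out v∉) (trans φv≡φw (sym ψu≡φw)))
        in v , v∈N ,
          decidable-stable (v ∈? S) (λ v∉ → v∉ (subst (_∈ S) (sym (v≡u v∉)) u∈)) , φv≡φw

    -- This supplies the neighbour inside `S` that `colours-seen` asks for, on either side.
    Full : Subset (n G) → Set
    Full S = ∀ d {x} → x ∈ S → ∃ λ u → u ∈ N d x × u ∈ S

    module _ (hole-at : ∀ {x} → x ∈ X → ∃ (Hole x)) where

      abstract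

        -- With the hole at a, the colour of p occurs nowhere on S, and it still does not
        -- after moving the hole inside S to x; so N d x sees it outside S.
        spread : S ⊆ T → T ⊆ X → NonSeparable G S → NonSeparable G T → Full S →
          ∀ {a p} → a ∈ S → p ∈ T → p ∉ S → Adj G a p →
          ∀ d {x} → x ∈ S → ∃ λ u → u ∈ N d x × u ∈ T × u ∉ S
        spread {S} {T} S⊆T T⊆X nsS nsT full {a} {p} a∈ p∈ p∉ adj d {x} x∈ =
          let (φ , h) = hole-at (T⊆X (S⊆T a∈))
              (e , p∈N) = Adj⇒N adj
              moved ψ hψ out re = move {S} (T⊆X ∘ S⊆T) (proj₁ nsS a x a∈ x∈) h
              (u₀ , u₀∈N , u₀∈) = full d x∈
              (u , u∈N , u∈T , ψu≡ψp) =
                colours-seen d T⊆X nsT (S⊆T x∈) hψ u₀∈N (S⊆T u₀∈) p∈ (∈∧∉⇒≢ x∈ p∉ ∘ sym)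
          in u , u∈N , u∈T , λ u∈ →
            let (w , w∈ , w≢a , φw≡ψu) = re u∈ (N⇒≢ d u∈N)
                (s , s∈N , s∈) = full e a∈
                (v , v∈N , v∈ , φv≡φw) = colours-seen e (T⊆X ∘ S⊆T) nsS a∈ h s∈N s∈ w∈ w≢a
                v≡p = rainbow e (T⊆X (S⊆T a∈)) h v∈N p∈N
                        (trans φv≡φw (trans φw≡ψu (trans ψu≡ψp (out p∉))))
            in p∉ (subst (_∈ S) v≡p v∈)

        -- With the hole at `z`, which sees all of `S` on one side, the colours on `S` are distinct.
        -- After shifting the hole to `x`, side `d` of `x` must show the colour of `y` inside `S`,
        -- and only `y` has it.
        cone-complete : S ⊆ X → NonSeparable G S → Full S → ∀ {z} → z ∈ X → z ∉ S →
          (∀ d {x} → x ∈ S → z ∈ N d x) → ∀ d {x y} → x ∈ S → y ∈ S → x ≢ y → y ∈ N d x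
        cone-complete {S} S⊆X ns full {z} z∈X z∉ apex d {x} {y} x∈ y∈ x≢y =
          let φ , h = hole-at z∈X
              u₀ , u₀∈N , u₀∈ = full d x∈
              v , v∈N , v∈ , eq = colours-seen d S⊆X ns x∈
                (shift z∈X (Adj-sym (N⇒Adj fwd (apex fwd x∈))) h) u₀∈N u₀∈ y∈ (x≢y ∘ sym)
              unchanged = λ {w} (w∈ : w ∈ S) →
                updateAt-minimal w z {const (φ x)} φ (∈∧∉⇒≢ w∈ z∉)
              v≡y = rainbow bwd z∈X h (∈N-flip fwd (apex fwd v∈)) (∈N-flip fwd (apex fwd y∈))
                      (trans (sym (unchanged v∈)) (trans eq (unchanged y∈)))
          in subst (_∈ N d x) v≡y v∈N

-- Induced paths and ears.

fromList : List (Fin k) → Subset k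
fromList = foldr (λ x p → ⁅ x ⁆ ∪ p) Sub.⊥

∈-fromList⁺ : ∀ {x : Fin k} {xs} → x LM.∈ xs → x ∈ fromList xs
∈-fromList⁺ (here refl) = x∈p∪q⁺ (inj₁ (x∈⁅x⁆ _))
∈-fromList⁺ (there x∈)  = x∈p∪q⁺ (inj₂ (∈-fromList⁺ x∈))

∈-fromList⁻ : ∀ {x : Fin k} xs → x ∈ fromList xs → x LM.∈ xs
∈-fromList⁻ [] x∈ = contradiction x∈ ∉⊥
∈-fromList⁻ (y ∷ xs) x∈ with x∈p∪q⁻ ⁅ y ⁆ (fromList xs) x∈
... | inj₁ x∈y  = here (x∈⁅y⁆⇒x≡y y x∈y)
... | inj₂ x∈xs = there (∈-fromList⁻ xs x∈xs)

module Ears (G : Digraph) where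

  open Walks G

  private
    variable
      x y z u v w r : V
      vs : List V
      S T B : Subset (n G)

  -- InducedPath y u vs: the vertices u ∷ vs form, in this order, an induced path ending in y.
  data InducedPath (y : V) : V → List V → Set where
    stop : InducedPath y y []
    cons : Adj G u v → All (λ w → ¬ Adj G u w × u ≢ w) vs →
           InducedPath y v vs → InducedPath y u (v ∷ vs)

  end∈ : InducedPath y u vs → y LM.∈ u ∷ vs
  end∈ stop         = here refl
  end∈ (cons _ _ π) = there (end∈ π)

  -- Jumping from `u` to the last vertex of the path equal or adjacent to `u` leaves no chord at
  -- `u`.
  reroute : InducedPath y v vs → ∀ u → Any (λ w → u ≡ w ⊎ Adj G u w) (v ∷ vs) →
    ∃ λ ws → InducedPath y u ws × (∀ {w} → w LM.∈ u ∷ ws → w ≡ u ⊎ w LM.∈ v ∷ vs)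
  reroute {v = v} {vs = vs} π u near
    with Any.any? (λ w → (u FinP.≟ w) ⊎-dec Adj? u w) vs
  reroute (cons _ _ π) u near | yes later =
    let (ws , ρ , sub) = reroute π u later in ws , ρ , Sum.map₂ there ∘ sub
  reroute π u (here (inj₁ refl)) | no ¬later = _ , π , inj₂
  reroute {v = v} {vs = vs} π u (here (inj₂ a)) | no ¬later =
    v ∷ vs ,
    cons a (All.map (λ ¬near → ¬near ∘ inj₂ , ¬near ∘ inj₁) (¬Any⇒All¬ vs ¬later)) π ,
    λ where
      (here refl) → inj₁ refl
      (there w∈)  → inj₂ w∈
  reroute π u (there later) | no ¬later = contradiction later ¬later

  first-entry : Walk G T u v → v ∈ S → ∃₂ λ y vs → y ∈ S × InducedPath y u vs ×
    (∀ {w} → w LM.∈ u ∷ vs → w ∈ T × (w ≡ y ⊎ w ∉ S))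
  first-entry {u = u} {S = S} ω v∈S with u ∈? S
  ... | yes u∈S = u , [] , u∈S , stop , λ where (here refl) → walk-start ω , inj₁ refl
  first-entry (here _) v∈S | no u∉S = contradiction v∈S u∉S
  first-entry {u = u} (step u∈ a ω) v∈S | no u∉S =
    let (y , vs , y∈ , π , loc) = first-entry ω v∈S
        (ws , ρ , sub) = reroute π u (here (inj₂ a))
    in y , ws , y∈ , ρ , λ w∈ → case sub w∈ of λ where
         (inj₁ refl) → u∈ , inj₂ u∉S
         (inj₂ w∈′)  → loc w∈′

  -- Serves to start an ear as late as possible, so that its later vertices have no further
  -- attachments.
  last-suffix : {P : V → Set} → Decidable P → InducedPath y u vs → Any P (u ∷ vs) →
    ∃₂ λ z ws → InducedPath y z ws × P z × ¬ Any P ws ×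
      (∀ {w} → w LM.∈ z ∷ ws → w LM.∈ u ∷ vs)
  last-suffix {vs = vs} P? π some with Any.any? P? vs
  last-suffix P? (cons _ _ π) some | yes later =
    let (z , ws , ρ , Pz , none , sub) = last-suffix P? π later in
    z , ws , ρ , Pz , none , there ∘ sub
  last-suffix P? π (here Pu) | no none = _ , _ , π , Pu , none , id
  last-suffix P? π (there later) | no none = contradiction later none

  -- The ear runs from `root` through `start` and `rest`, whose last vertex is `end`. By `quiet`,
  -- only `start` can have neighbours in `S` other than `end`.
  record Ear (S B : Subset (n G)) : Set where
    field
      root start end : V
      rest           : List V
      root∈S         : root ∈ S
      end∈S          : end ∈ S
      root≢end       : root ≢ end
      root~start     : Adj G root start
      start∉S        : start ∉ S
      path           : InducedPath end start rest
      locate         : w LM.∈ start ∷ rest → w ∈ B × (w ≡ end ⊎ w ∉ S)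
      quiet          : w LM.∈ rest → w ∉ S → v ∈ S → Adj G w v → v ≡ end

  -- An edge from `a` to `p` leaves `S`; as `B - a` is connected, a path returns from `p` to `S` at
  -- some `y` other than `a`.
  ear-exists : NonSeparable G B → S ⊆ B → u ∈ S → v ∈ S → u ≢ v → w ∈ B → w ∉ S → Ear S B
  ear-exists {B} {S} {u} {v} {w} (conn , cut) S⊆B u∈ v∈ u≢v w∈ w∉
    with exit u∈ w∉ (conn u w (S⊆B u∈) w∈)
  ... | a , p , a∈ , p∈ , p∉ , a~p =
    let t , t∈ , t≢a = other
        y , ps , y∈ , π , loc = first-entry
          (cut a (S⊆B a∈) p t (x∈p∧x≢y⇒x∈p-y p∈ (Adj-irrefl a~p ∘ sym))
             (x∈p∧x≢y⇒x∈p-y (S⊆B t∈) t≢a)) t∈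
        y≢a = x∈p-y⇒x≢y B a (proj₁ (loc (end∈ π)))
        -- The vertex `p` is attached to `a`, which is not `y`, so there is a last vertex attached
        -- to `S` elsewhere than at `y`. It becomes `start`.
        z , zs , ρ , (z∉ , x , x∈ , x≢y , z~x) , none , sub =
          last-suffix (attached? y) π (here (p∉ , a , a∈ , y≢a ∘ sym , Adj-sym a~p))
    in record
      { root∈S = x∈ ; end∈S = y∈ ; root≢end = x≢y ; root~start = Adj-sym z~x ; start∉S = z∉ ; path = ρ
      ; locate = λ w∈ → let (w∈B-a , w∉S) = loc (sub w∈) in x∈p-y⇒x∈p B a w∈B-a , w∉S
      ; quiet = λ {t} {s} t∈ t∉ s∈ t~s → decidable-stable (s FinP.≟ y) λ s≢y →
          none (LM.lose t∈ (t∉ , s , s∈ , s≢y , t~s))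
      }
    where
    other : ∃ λ t → t ∈ S × t ≢ a
    other with u FinP.≟ a
    ... | yes refl = v , v∈ , u≢v ∘ sym
    ... | no u≢a   = u , u∈ , u≢a

    attached? : ∀ y → Decidable (λ t → t ∉ S × ∃ λ s → s ∈ S × s ≢ y × Adj G t s)
    attached? y t = ¬? (t ∈? S) ×-dec
      FinP.any? λ s → (s ∈? S) ×-dec ¬? (s FinP.≟ y) ×-dec Adj? t s

  path-walk : InducedPath y u vs → (∀ {w} → w LM.∈ u ∷ vs → w ∈ T) → w LM.∈ u ∷ vs → Walk G T w y
  path-walk stop ⊆T (here refl) = here (⊆T (here refl))
  path-walk (cons a _ π) ⊆T (here refl) =
    step (⊆T (here refl)) a (path-walk π (⊆T ∘ there) (here refl))
  path-walk (cons _ _ π) ⊆T (there w∈) = path-walk π (⊆T ∘ there) w∈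

  head∉tail : InducedPath y u vs → w LM.∈ vs → w ≢ u
  head∉tail (cons a _ _) (here refl) = Adj-irrefl a ∘ sym
  head∉tail (cons _ apart _) (there w∈) = proj₂ (All.lookup apart w∈) ∘ sym

  -- Deleting one vertex cuts the path into at most two pieces, each containing an end of the path.
  split-walk : InducedPath y u vs → (∀ {w} → w LM.∈ u ∷ vs → w ∈ T) → ∀ r →
    w LM.∈ u ∷ vs → w ≢ r → Walk G (T - r) w y ⊎ Walk G (T - r) w u
  split-walk π ⊆T r (here refl) w≢r = inj₂ (here (x∈p∧x≢y⇒x∈p-y (⊆T (here refl)) w≢r))
  split-walk {u = u} ρ@(cons a _ π) ⊆T r (there w∈) w≢r with u FinP.≟ r
  ... | yes refl = inj₁ (path-walk π
          (λ w∈ → x∈p∧x≢y⇒x∈p-y (⊆T (there w∈)) (head∉tail ρ w∈)) w∈)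
  ... | no u≢r = Sum.map₂
          (λ ω → walk-trans ω (step (walk-end ω) (Adj-sym a)
                   (here (x∈p∧x≢y⇒x∈p-y (⊆T (here refl)) u≢r))))
          (split-walk π (⊆T ∘ there) r w∈ w≢r)

  -- After deleting `r`, what remains of the ear still reaches `S` at `x` or `y`, and what remains
  -- of `S` is connected. The cases are `r` equal to `y`, another vertex of `S`, or an inner vertex
  -- of the ear.
  attach-ear : NonSeparable G S → x ∈ S → y ∈ S → x ≢ y → Adj G x z → InducedPath y z vs →
    (∀ {w} → w LM.∈ z ∷ vs → w ≡ y ⊎ w ∉ S) → NonSeparable G (S ∪ fromList (z ∷ vs))
  attach-ear {S} {x} {y} {z} {vs} (conn , cut) x∈ y∈ x≢y x~z π loc =
    connected-via y (λ {w} w∈ → case locate w∈ of λ where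
      (inj₁ w∈S) → walk-mono S⊆U (conn w y w∈S y∈)
      (inj₂ w∈π) → path-walk π π⊆U w∈π) ,
    λ r r∈ → cut′ r
    where
    U : Subset (n G)
    U = S ∪ fromList (z ∷ vs)

    S⊆U : S ⊆ U
    S⊆U = p⊆p∪q _

    π⊆U : ∀ {w} → w LM.∈ z ∷ vs → w ∈ U
    π⊆U = q⊆p∪q S _ ∘ ∈-fromList⁺

    locate : w ∈ U → w ∈ S ⊎ w LM.∈ z ∷ vs
    locate = Sum.map₂ (∈-fromList⁻ (z ∷ vs)) ∘ x∈p∪q⁻ S _

    keep : ∀ {r w} → w ∈ U → w ≢ r → w ∈ U - r
    keep = x∈p∧x≢y⇒x∈p-y

    S-⊆U- : ∀ r → S - r ⊆ U - r
    S-⊆U- r w∈ = keep (S⊆U (x∈p-y⇒x∈p S r w∈)) (x∈p-y⇒x≢y S r w∈)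

    cut′ : ∀ r → Connected G (U - r)
    cut′ r with r FinP.≟ y
    ... | yes refl = connected-via x λ {w} w∈ →
      let w≢y = x∈p-y⇒x≢y U y w∈ in
      case locate (x∈p-y⇒x∈p U y w∈) of λ where
        (inj₁ w∈S) → walk-mono (S-⊆U- y)
          (cut y y∈ w x (x∈p∧x≢y⇒x∈p-y w∈S w≢y) (x∈p∧x≢y⇒x∈p-y x∈ x≢y))
        (inj₂ w∈π) → case split-walk π π⊆U y w∈π w≢y of λ where
          (inj₁ ω) → contradiction refl (x∈p-y⇒x≢y U y (walk-end ω))
          (inj₂ ω) → walk-trans ω (step (walk-end ω) (Adj-sym x~z) (here (keep (S⊆U x∈) x≢y)))
    ... | no r≢y with r ∈? S
    ... | yes r∈S = connected-via y λ {w} w∈ →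
      case locate (x∈p-y⇒x∈p U r w∈) of λ where
        (inj₁ w∈S) → walk-mono (S-⊆U- r)
          (cut r r∈S w y (x∈p∧x≢y⇒x∈p-y w∈S (x∈p-y⇒x≢y U r w∈))
             (x∈p∧x≢y⇒x∈p-y y∈ (r≢y ∘ sym)))
        (inj₂ w∈π) → path-walk π
          (λ v∈ → keep (π⊆U v∈) (case loc v∈ of λ where
             (inj₁ refl) → r≢y ∘ sym
             (inj₂ v∉S)  → λ where refl → v∉S r∈S)) w∈π
    ... | no r∉S = connected-via y λ {w} w∈ →
      case locate (x∈p-y⇒x∈p U r w∈) of λ where
        (inj₁ w∈S) → walk-mono S⊆U-r (conn w y w∈S y∈)
        (inj₂ w∈π) → case split-walk π π⊆U r w∈π (x∈p-y⇒x≢y U r w∈) of λ where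
          (inj₁ ω) → ω
          (inj₂ ω) → walk-trans ω (step (walk-end ω) (Adj-sym x~z)
                       (walk-mono S⊆U-r (conn x y x∈ y∈)))
      where
      S⊆U-r : S ⊆ U - r
      S⊆U-r v∈ = keep (S⊆U v∈) (∈∧∉⇒≢ v∈ r∉S)

-- Induced cycles from induced paths.

module Cycles (G : Digraph) where

  open Walks G
  open Ears G

  private
    variable
      x y z u v w r : V
      vs : List V
      S T B : Subset (n G)

  -- An induced cycle of the underlying graph, of length `suc m`; the directions of its arcs are
  -- left open.
  record InducedCycle (T : Subset (n G)) : Set where
    field
      m           : ℕ
      2≤m         : 2 ≤ m
      c           : Fin (suc m) → V
      enumerates  : Enumerates G T c
      consecutive : ∀ i → Adj G (c i) (c (next i))
      chordless   : ∀ i j → Adj G (c i) (c j) → j ≡ next i ⊎ i ≡ next j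

  lookup-last : InducedPath y u vs → lookup (u ∷ vs) (fromℕ (length vs)) ≡ y
  lookup-last stop         = refl
  lookup-last (cons _ _ π) = lookup-last π

  path-consecutive : InducedPath y u vs → ∀ i → Adj G (lookup (u ∷ vs) (inject₁ i)) (lookup vs i)
  path-consecutive (cons a _ _) zero    = a
  path-consecutive (cons _ _ π) (suc i) = path-consecutive π i

  path-chordless : InducedPath y u vs → ∀ i j → Adj G (lookup (u ∷ vs) i) (lookup (u ∷ vs) j) →
    i ⋖ j ⊎ j ⋖ i
  path-chordless π zero zero a = contradiction refl (Adj-irrefl a)
  path-chordless (cons _ _ _) zero (suc zero) a = inj₁ (zero , refl , refl)
  path-chordless (cons _ apart _) zero (suc (suc j)) a =
    contradiction a (proj₁ (All.lookup apart (∈-lookup j)))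
  path-chordless (cons _ _ _) (suc zero) zero a = inj₂ (zero , refl , refl)
  path-chordless (cons _ apart _) (suc (suc i)) zero a =
    contradiction (Adj-sym a) (proj₁ (All.lookup apart (∈-lookup i)))
  path-chordless (cons _ _ π) (suc i) (suc j) a = Sum.map suc-⋖ suc-⋖ (path-chordless π i j a)

  path-injective : InducedPath y u vs → Injective _≡_ _≡_ (lookup (u ∷ vs))
  path-injective π {zero} {zero} eq = refl
  path-injective π {zero} {suc j} eq = contradiction (sym eq) (head∉tail π (∈-lookup j))
  path-injective π {suc i} {zero} eq = contradiction eq (head∉tail π (∈-lookup i))
  path-injective (cons _ _ π) {suc i} {suc j} eq = cong suc (path-injective π eq)

  -- The vertex `x` becomes position `zero`. Its only neighbours on the path are the two ends, so
  -- the closed path has no chord.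
  close-path : InducedPath y z vs → ¬ x LM.∈ z ∷ vs → z ≢ y → Adj G x z → Adj G x y →
    (∀ {w} → w LM.∈ vs → Adj G x w → w ≡ y) →
    (∀ {w} → (w ∈ T → w ≡ x ⊎ w LM.∈ z ∷ vs) × (w ≡ x ⊎ w LM.∈ z ∷ vs → w ∈ T)) →
    InducedCycle T
  close-path {y} {z} {[]} π x∉ z≢y x~z x~y only T⇔ = contradiction (lookup-last π) z≢y
  close-path {y} {z} {vs@(_ ∷ _)} {x} {T} π x∉ z≢y x~z x~y only T⇔ = record
    { m = suc (length vs)
    ; 2≤m = s≤s (s≤s z≤n)
    ; c = lookup xs
    ; enumerates = inj , (λ i → proj₂ T⇔ (from (∈-lookup {xs = xs} i))) ,
        λ w w∈ → let p = to (proj₁ T⇔ w∈) in Any.index p , sym (lookup-index p)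
    ; consecutive = consec
    ; chordless = chordless
    }
    where
    xs : List V
    xs = x ∷ z ∷ vs

    from : ∀ {w} → w LM.∈ xs → w ≡ x ⊎ w LM.∈ z ∷ vs
    from (here w≡x) = inj₁ w≡x
    from (there w∈) = inj₂ w∈

    to : ∀ {w} → w ≡ x ⊎ w LM.∈ z ∷ vs → w LM.∈ xs
    to (inj₁ w≡x) = here w≡x
    to (inj₂ w∈)  = there w∈

    inj : Injective _≡_ _≡_ (lookup xs)
    inj {zero} {zero} eq = refl
    inj {zero} {suc j} eq = contradiction (subst (LM._∈ z ∷ vs) (sym eq) (∈-lookup {xs = z ∷ vs} j)) x∉
    inj {suc i} {zero} eq = contradiction (subst (LM._∈ z ∷ vs) eq (∈-lookup {xs = z ∷ vs} i)) x∉
    inj {suc i} {suc j} eq = cong suc (path-injective π eq)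

    consec : ∀ i → Adj G (lookup xs i) (lookup xs (next i))
    consec i with view i
    ... | ‵fromℕ = subst₂ (Adj G) (sym (lookup-last π))
                     (cong (lookup xs) (sym (next-fromℕ (suc (length vs))))) (Adj-sym x~y)
    ... | ‵inj₁ {i = zero} _ = subst (Adj G x) (cong (lookup xs) (sym (next-inject₁ zero))) x~z
    ... | ‵inj₁ {i = suc j} _ = subst (Adj G (lookup (z ∷ vs) (inject₁ j)))
            (cong (lookup xs) (sym (next-inject₁ (suc j)))) (path-consecutive π j)

    from-x : ∀ j → Adj G x (lookup (z ∷ vs) j) → suc j ≡ next zero ⊎ zero ≡ next (suc j)
    from-x zero a = inj₁ (sym (next-inject₁ zero))
    from-x (suc j) a = inj₂ (sym (trans (cong (next ∘ suc) j≡last) (next-fromℕ (suc (length vs)))))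
      where
      j≡last : suc j ≡ fromℕ (length vs)
      j≡last = path-injective π (trans (only (∈-lookup j) a) (sym (lookup-last π)))

    chordless : ∀ i j → Adj G (lookup xs i) (lookup xs j) → j ≡ next i ⊎ i ≡ next j
    chordless zero zero a = contradiction refl (Adj-irrefl a)
    chordless zero (suc j) a = from-x j a
    chordless (suc i) zero a = swap (from-x i (Adj-sym a))
    chordless (suc i) (suc j) a =
      Sum.map (⋖⇒next ∘ suc-⋖) (⋖⇒next ∘ suc-⋖) (path-chordless π i j a)

-- Induced cycles are directed cycles or symmetric odd cycles.

module Rotation (G : Digraph) (L : Fin (n G) → List ℕ) (X : Subset (n G))
  (uncolourable : ¬ Dicolourable G ⊤ L) (bound : ∀ x → x ∈ X → dmax G x ≤ ∣ L x ∣ₗ)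
  (hole-at : ∀ {x} → x ∈ X → ∃ (Colouring.Hole G L x)) where

  open Walks G
  open Cycles G
  open Colouring G L
  open Holes X uncolourable bound

  abstract
    -- If w were the only neighbour of y in S, all of S − y would have one colour, also after
    -- the hole has moved to x, where u and v need different colours.
    second-neighbour : ∀ {S} → S ⊆ X → NonSeparable G S →
      ∀ d {x u v} → x ∈ S → u ∈ N d x → u ∈ S → v ∈ N d x → v ∈ S → u ≢ v →
      ∀ e {y w} → y ∈ S → w ∈ N e y → w ∈ S → ∃ λ t → t ∈ N e y × t ∈ S × t ≢ w
    second-neighbour {S} S⊆X ns d {x} {u} {v} x∈ u∈N u∈ v∈N v∈ u≢v e {y} {w} y∈ w∈N w∈
      with FinP.any? (λ t → (t ∈? N e y) ×-dec (t ∈? S) ×-dec ¬? (t FinP.≟ w))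
    ... | yes found = found
    ... | no none =
      let φ , h = hole-at (S⊆X y∈)
          moved ψ hψ _ re = move S⊆X (proj₁ ns y x y∈ x∈) h
          constant = λ {s} (s∈ : s ∈ S) (s≢y : s ≢ y) →
            let t , t∈N , t∈ , φt≡φs = colours-seen e S⊆X ns y∈ h w∈N w∈ s∈ s≢y
                t≡w = decidable-stable (t FinP.≟ w) (λ t≢w → none (t , t∈N , t∈ , t≢w))
            in trans (sym φt≡φs) (cong φ t≡w)
          ψ≡φw = λ {s} (s∈ : s ∈ S) (s∈N : s ∈ N d x) →
            let t , t∈ , t≢y , φt≡ψs = re s∈ (N⇒≢ d s∈N)
            in trans (sym φt≡ψs) (constant t∈ t≢y)
      in contradiction
           (rainbow d (S⊆X x∈) hψ u∈N v∈N (trans (ψ≡φw u∈ u∈N) (sym (ψ≡φw v∈ v∈N)))) u≢v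

  module _ {T : Subset (n G)} (T⊆X : T ⊆ X) (ns : NonSeparable G T) {m : ℕ} (2≤m : 2 ≤ m)
    (c : Fin (suc m) → V) (enumerates : Enumerates G T c)
    (consecutive : ∀ i → Adj G (c i) (c (next i)))
    (chordless : ∀ i j → Adj G (c i) (c j) → j ≡ next i ⊎ i ≡ next j) where

    private
      c-injective : Injective _≡_ _≡_ c
      c-injective = proj₁ enumerates

      c∈ : ∀ i → c i ∈ T
      c∈ = proj₁ (proj₂ enumerates)

    Along : Direction → Fin (suc m) → Set
    Along d i = c (next i) ∈ N d (c i)

    -- Centred at `next i`, so that the predecessor on the cycle is simply `c i`.
    Both : Direction → Fin (suc m) → Set
    Both d i = c i ∈ N d (c (next i)) × c (next (next i)) ∈ N d (c (next i))

    along : ∀ i → ∃ λ d → Along d i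
    along i = Adj⇒N (consecutive i)

    along⇒back : ∀ d {i} → Along d i → c i ∈ N (flip d) (c (next i))
    along⇒back d = ∈N-flip d

    along-back : ∀ d {i} → Along (flip d) i → c i ∈ N d (c (next i))
    along-back fwd = ∈N-flip bwd
    along-back bwd = ∈N-flip fwd

    two-neighbours : ∀ i {v} → v ∈ T → Adj G (c (next i)) v → v ≡ c i ⊎ v ≡ c (next (next i))
    two-neighbours i {v} v∈ a with proj₂ (proj₂ enumerates) v v∈
    ... | j , refl = Sum.swap (Sum.map (cong c) (cong c ∘ sym ∘ next-injective)
                       (chordless (next i) j a))

    ends-≢ : ∀ i → c i ≢ c (next (next i))
    ends-≢ i eq = next²-≢ 2≤m i (sym (c-injective eq))

    Two : Set
    Two = ∃₂ λ d i → Both d i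

    two? : Dec Two
    two? with FinP.any? (both? fwd) | FinP.any? (both? bwd)
      where
      both? : ∀ d i → Dec (Both d i)
      both? d i = (_ ∈? _) ×-dec (_ ∈? _)
    ... | yes w | _     = yes (fwd , w)
    ... | no _  | yes w = yes (bwd , w)
    ... | no ¬f | no ¬b = no λ where
      (fwd , w) → ¬f w
      (bwd , w) → ¬b w

    -- By `second-neighbour`, no vertex has exactly one neighbour in `T` on a side; the second one
    -- can only be the other neighbour on the cycle.
    both-everywhere : Two → ∀ e j → Along (flip e) j ⊎ Along e (next j) → Both e j
    both-everywhere (d , i , p , q) e j (inj₁ a) = back , forth
      where
      back = along-back e a
      forth : c (next (next j)) ∈ N e (c (next j))
      forth =
        let t , t∈N , t∈ , t≢ = second-neighbour T⊆X ns d (c∈ (next i)) p (c∈ i) q (c∈ _) (ends-≢ i)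
              e (c∈ (next j)) back (c∈ j)
        in [ (λ t≡ → contradiction t≡ t≢) , (λ t≡ → subst (_∈ N e (c (next j))) t≡ t∈N) ]′
             (two-neighbours j t∈ (N⇒Adj e t∈N))
    both-everywhere (d , i , p , q) e j (inj₂ forth) = back , forth
      where
      back : c j ∈ N e (c (next j))
      back =
        let t , t∈N , t∈ , t≢ = second-neighbour T⊆X ns d (c∈ (next i)) p (c∈ i) q (c∈ _) (ends-≢ i)
              e (c∈ (next j)) forth (c∈ _)
        in [ (λ t≡ → subst (_∈ N e (c (next j))) t≡ t∈N) , (λ t≡ → contradiction t≡ t≢) ]′
             (two-neighbours j t∈ (N⇒Adj e t∈N))

    along-all : ∀ d → (∀ i → Along d i → Along d (next i)) → Along d zero → ∀ i → Along d i
    along-all d hop a₀ i = subst (Along d) (turn-toℕ i) (go (toℕ i))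
      where
      go : ∀ t → Along d (turn t)
      go zero    = a₀
      go (suc t) = hop (turn t) (go t)

    module Alternating (two : Two) where

      both : ∀ i → ∃ λ e → Both e i
      both i = let e , a = along (next i) in e , both-everywhere two e i (inj₂ a)

      -- Seen from `c (next i)`, the vertex `c i` lies on side `flip d`; hence so does the next
      -- vertex.
      alternate : ∀ d i → Along d i → Along (flip d) (next i)
      alternate fwd i a = proj₂ (both-everywhere two bwd i (inj₁ a))
      alternate bwd i a = proj₂ (both-everywhere two fwd i (inj₁ a))

      -- Shifting the hole twice around the cycle keeps the token just behind it of the
      -- same colour as the token left at position 1.
      Round : ℕ → Set
      Round k = ∃ λ ψ → Hole (c (turn (suc k))) ψ × ψ (c (turn k)) ≡ ψ (c (turn 1))

      abstract
        -- With the hole at `p₁`, the colour of `p₃` must show at `p₀` or `p₂`. If at `p₂`, a shift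
        -- to `p₂` would put it on both neighbours of the hole, on one side. So `p₃` has the colour
        -- of `p₀`, and two shifts bring it just behind the hole. The bounds on `k` keep position 1
        -- untouched.
        advance : ∀ k → 1 ≤ k → suc (suc k) ≤ m → Round k → Round (suc (suc k))
        advance k 1≤k k+2≤m (ψ , h , same) =
          let e , back , forth = both (turn k)
              e′ , back′ , forth′ = both (turn (suc k))
              v , v∈N , v∈ , ψv≡ = colours-seen e T⊆X ns (c∈ p₁) h back (c∈ p₀) (c∈ p₃)
                                     (ends-≢ p₁ ∘ sym)
              h′ = shift (T⊆X (c∈ p₁)) (consecutive p₁) h
              h″ = shift (T⊆X (c∈ p₂)) (consecutive p₂) h′
              ψ′ = ψ [ c p₁ ≔ ψ (c p₂) ]
              ψ′p₃ = updateAt-minimal (c p₃) (c p₁) ψ (ends-≢ p₁ ∘ sym)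
              ψp₃ : ψ (c p₃) ≡ ψ (c (turn 1))
              ψp₃ = [ (λ v≡ → trans (sym ψv≡) (trans (cong ψ v≡) same))
                    , (λ v≡ → contradiction
                        (rainbow e′ (T⊆X (c∈ p₂)) h′ back′ forth′
                          (trans (updateAt-updates (c p₁) ψ)
                            (trans (cong ψ (sym v≡)) (trans ψv≡ (sym ψ′p₃)))))
                        (ends-≢ p₁)) ]′
                    (two-neighbours p₀ v∈ (N⇒Adj e v∈N))
          in ψ′ [ c p₂ ≔ ψ′ (c p₃) ] , h″ ,
             trans (updateAt-updates (c p₂) ψ′)
               (trans ψ′p₃ (trans ψp₃ (sym
                 (trans (updateAt-minimal (c (turn 1)) (c p₂) ψ′ (first≢ (s≤s (ℕP.m≤n⇒m≤1+n 1≤k)) k+2≤m))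
                   (updateAt-minimal (c (turn 1)) (c p₁) ψ (first≢ (s≤s 1≤k) (ℕP.<⇒≤ k+2≤m)))))))
          where
          p₀ p₁ p₂ p₃ : Fin (suc m)
          p₀ = turn k
          p₁ = turn (suc k)
          p₂ = turn (suc (suc k))
          p₃ = turn (suc (suc (suc k)))

          first≢ : ∀ {t} → 1 < t → t ≤ m → c (turn 1) ≢ c (turn t)
          first≢ 1<t t≤m = turn-≢ 1<t t≤m ∘ c-injective

        go-round : ∀ t → odd t ≤ m → Round (odd t)
        -- With the hole at position 2, the token just behind it is the one at position 1 itself.
        go-round zero    _   = let ψ , h = hole-at (T⊆X (c∈ (turn 2))) in ψ , h , refl
        go-round (suc t) t≤m =
          advance (odd t) (1≤odd t) t≤m (go-round t (ℕP.≤-trans (ℕP.m≤n+m (odd t) 2) t≤m))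

        -- The hole arrives at position 0, between the positions `m` and 1. These carry equal
        -- colours on one side of the hole, against `rainbow`.
        even-length-absurd : ∀ t → m ≢ odd t
        even-length-absurd t refl =
          let ψ , h , same = go-round t ℕP.≤-refl
              e , back , forth = both (turn m)
              last≡first = rainbow e (T⊆X (c∈ _)) h back
                (subst (λ i → c (next i) ∈ N e (c (turn (suc m)))) (turn-full m) forth) same
          in turn-≢ 2≤m ℕP.≤-refl (sym (c-injective last≡first))

      alternates : ∀ d → Along d zero → ∀ t → Along d (turn (2 * t))
      alternates d a zero = a
      alternates d a (suc t) =
        subst₂ (λ e s → Along e (turn s)) (flip-flip d) (sym (ℕP.*-suc 2 t))
          (alternate (flip d) _ (alternate d _ (alternates d a t)))

      -- Directions alternate and the length `m + 1` is odd, so one full turn yields the opposite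
      -- direction at position 0. Alternation spreads both directions to every position.
      symmetric : ∀ t → m ≡ 2 * t → ∀ d i → Along d i
      symmetric t refl d i = subst (Along d) (turn-toℕ i) (along-turn (toℕ i) d)
        where
        flip-at-zero : ∀ d → Along d zero → Along (flip d) zero
        flip-at-zero d a = subst (Along (flip d)) (turn-full m) (alternate d _ (alternates d a t))

        at-zero : ∀ d → Along d zero
        at-zero d with along zero | d
        ... | fwd , a | fwd = a
        ... | bwd , a | bwd = a
        ... | fwd , a | bwd = flip-at-zero fwd a
        ... | bwd , a | fwd = flip-at-zero bwd a

        along-turn : ∀ s d → Along d (turn s)
        along-turn zero    d   = at-zero d
        along-turn (suc s) fwd = alternate bwd _ (along-turn s bwd)
        along-turn (suc s) bwd = alternate fwd _ (along-turn s fwd)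

    -- A change of direction would give the vertex between two consecutive edges two neighbours on
    -- one side; so would a symmetric edge together with the next edge.
    directed : ¬ Two → ∃ λ d → ∀ i → Along d i × ¬ Along (flip d) i
    directed ¬two =
      let d , a₀ = along zero
          all = along-all d (hop d) a₀
      in d , λ i → all i , λ a → ¬two (d , i , along-back d a , all (next i))
      where
      hop : ∀ d i → Along d i → Along d (next i)
      hop d i a with along (next i) | d
      ... | fwd , a′ | fwd = a′
      ... | bwd , a′ | bwd = a′
      ... | bwd , a′ | fwd = contradiction (bwd , i , along⇒back fwd a , a′) ¬two
      ... | fwd , a′ | bwd = contradiction (fwd , i , along⇒back bwd a , a′) ¬two

    full-if : (∀ d i → ∃ λ j → c j ∈ N d (c i)) → Full T
    full-if adj d {x} x∈ with proj₂ (proj₂ enumerates) x x∈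
    ... | i , refl = let j , cj∈ = adj d i in c j , cj∈ , c∈ j

    directed-cycle : (∀ i → Along fwd i × ¬ Along bwd i) → IsDirectedCycle G T
    directed-cycle dir = m , ℕP.<⇒≤ 2≤m , c , enumerates , λ i j →
      (λ arc → [ id , (λ where refl → contradiction (∈N⁺ bwd arc) (proj₂ (dir j))) ]′
                 (chordless i j (inj₁ arc))) ,
      (λ where refl → ∈N⁻ fwd (proj₁ (dir i)))

    -- The arcs run against `c`, so the vertices are listed in reverse.
    directed-cycle-reversed : (∀ i → Along bwd i × ¬ Along fwd i) → IsDirectedCycle G T
    directed-cycle-reversed dir = m , ℕP.<⇒≤ 2≤m , c ∘ opposite ,
      ( opposite-injective ∘ c-injective
      , c∈ ∘ opposite
      , λ w w∈ → let i , eq = proj₂ (proj₂ enumerates) w w∈ in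
          opposite i , trans (cong c (FinP.opposite-involutive i)) eq) ,
      λ i j →
        (λ arc → [ (λ eq → contradiction (∈N⁺ fwd (subst (λ k → Arc G (c (opposite i)) (c k)) eq arc))
                             (proj₂ (dir (opposite i))))
                 , (λ eq → opposite-injective
                     (next-injective (trans (sym eq) (sym (next-opposite-next i))))) ]′
                 (chordless (opposite i) (opposite j) (inj₁ arc))) ,
        (λ where refl → subst (λ k → Arc G (c k) (c (opposite (next i)))) (next-opposite-next i)
                          (∈N⁻ bwd (proj₁ (dir (opposite (next i))))))
      where
      opposite-injective : ∀ {i j : Fin (suc m)} → opposite i ≡ opposite j → i ≡ j
      opposite-injective {i} {j} eq = trans (sym (FinP.opposite-involutive i))
        (trans (cong opposite eq) (FinP.opposite-involutive j))

    classify : Full T × (IsDirectedCycle G T ⊎ IsSymmetricOddCycle G T)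
    classify with two?
    ... | no ¬two = let d , dir = directed ¬two in
      full-if (adjacent d (proj₁ ∘ dir)) , inj₁ (oriented d dir)
      where
      oriented : ∀ d → (∀ i → Along d i × ¬ Along (flip d) i) → IsDirectedCycle G T
      oriented fwd = directed-cycle
      oriented bwd = directed-cycle-reversed

      adjacent : ∀ d → (∀ i → Along d i) → ∀ e i → ∃ λ j → c j ∈ N e (c i)
      adjacent fwd all fwd i = next i , all i
      adjacent bwd all bwd i = next i , all i
      adjacent fwd all bwd i with next-surjective i
      ... | j , refl = j , along⇒back fwd (all j)
      adjacent bwd all fwd i with next-surjective i
      ... | j , refl = j , along⇒back bwd (all j)
    ... | yes two with parity m
    ... | inj₂ (t , m≡odd) = contradiction m≡odd (Alternating.even-length-absurd two t)
    ... | inj₁ (t , m≡2t) =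
      full-if (λ d i → next i , all d i) ,
      inj₂ (odd-cycle t m≡2t 2≤m enumerates chordless (∈N⁻ fwd ∘ all fwd) (∈N⁻ bwd ∘ all bwd))
      where
      all : ∀ d i → Along d i
      all = Alternating.symmetric two t m≡2t

      odd-cycle : ∀ {m c} t → m ≡ 2 * t → 2 ≤ m → Enumerates G T {suc m} c →
        (∀ i j → Adj G (c i) (c j) → j ≡ next i ⊎ i ≡ next j) →
        (∀ i → Arc G (c i) (c (next i))) → (∀ i → Arc G (c (next i)) (c i)) →
        IsSymmetricOddCycle G T
      odd-cycle {c = c} (suc t) refl _ enum ch forth back = suc t , s≤s z≤n , c , enum , λ i j →
        (λ arc → ch i j (inj₁ arc)) ,
        λ where
          (inj₁ refl) → forth i
          (inj₂ refl) → back j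

-- p has at least three elements.
Large : Subset k → Set
Large p = ∀ x y → ∃ λ t → t ∈ p × t ≢ x × t ≢ y

three⇒large : ∀ {a b c} {p : Subset k} → a ∈ p → b ∈ p → c ∈ p →
  a ≢ b → a ≢ c → b ≢ c → Large p
three⇒large {a = a} {b} {c} a∈ b∈ c∈ a≢b a≢c b≢c x y with hit? a | hit? b | hit? c
  where
  hit? : ∀ t → Dec (t ≡ x ⊎ t ≡ y)
  hit? t = (t FinP.≟ x) ⊎-dec (t FinP.≟ y)
... | no a∉ | _ | _ = a , a∈ , a∉ ∘ inj₁ , a∉ ∘ inj₂
... | _ | no b∉ | _ = b , b∈ , b∉ ∘ inj₁ , b∉ ∘ inj₂
... | _ | _ | no c∉ = c , c∈ , c∉ ∘ inj₁ , c∉ ∘ inj₂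
... | yes (inj₁ refl) | yes (inj₁ refl) | _ = contradiction refl a≢b
... | yes (inj₂ refl) | yes (inj₂ refl) | _ = contradiction refl a≢b
... | yes (inj₁ refl) | _ | yes (inj₁ refl) = contradiction refl a≢c
... | yes (inj₂ refl) | _ | yes (inj₂ refl) = contradiction refl a≢c
... | _ | yes (inj₁ refl) | yes (inj₁ refl) = contradiction refl b≢c
... | _ | yes (inj₂ refl) | yes (inj₂ refl) = contradiction refl b≢c

∈-∪-pair : ∀ {S : Subset k} {s x v} → x ∈ S → v ∈ S ∪ fromList (s ∷ x ∷ []) → v ≡ s ⊎ v ∈ S
∈-∪-pair {S = S} {s} {x} x∈ v∈ with x∈p∪q⁻ S _ v∈
... | inj₁ v∈S = inj₂ v∈S
... | inj₂ v∈π with ∈-fromList⁻ (s ∷ x ∷ []) v∈π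
... | here v≡s          = inj₁ v≡s
... | there (here refl) = inj₂ x∈

-- Edges and their ears.

module Pairs (G : Digraph) where

  open Walks G
  open Ears G
  open Cycles G

  pair : V → V → Subset (n G)
  pair a b = ⁅ a ⁆ ∪ ⁅ b ⁆

  ∈-pairˡ : ∀ {a b} → a ∈ pair a b
  ∈-pairˡ {a} = x∈p∪q⁺ (inj₁ (x∈⁅x⁆ a))

  ∈-pairʳ : ∀ {a b} → b ∈ pair a b
  ∈-pairʳ {b = b} = x∈p∪q⁺ (inj₂ (x∈⁅x⁆ b))

  ∈-pair⁻ : ∀ {a b w} → w ∈ pair a b → w ≡ a ⊎ w ≡ b
  ∈-pair⁻ {a} {b} = Sum.map (x∈⁅y⁆⇒x≡y a) (x∈⁅y⁆⇒x≡y b) ∘ x∈p∪q⁻ ⁅ a ⁆ ⁅ b ⁆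

  pair-nonseparable : ∀ {a b} → Adj G a b → NonSeparable G (pair a b)
  pair-nonseparable {a} {b} a~b =
    connected-via a (λ w∈ → case ∈-pair⁻ w∈ of λ where
      (inj₁ refl) → here ∈-pairˡ
      (inj₂ refl) → step ∈-pairʳ (Adj-sym a~b) (here ∈-pairˡ)) ,
    λ v v∈ u w u∈ w∈ → subst (Walk G _ u)
      (equal (∈-pair⁻ v∈) (∈-pair⁻ (x∈p-y⇒x∈p _ v u∈)) (∈-pair⁻ (x∈p-y⇒x∈p _ v w∈))
        (x∈p-y⇒x≢y _ v u∈) (x∈p-y⇒x≢y _ v w∈))
      (here u∈)
    where
    equal : ∀ {u v w} → v ≡ a ⊎ v ≡ b → u ≡ a ⊎ u ≡ b → w ≡ a ⊎ w ≡ b → u ≢ v → w ≢ v → u ≡ w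
    equal _ (inj₁ refl) (inj₁ refl) _ _ = refl
    equal _ (inj₂ refl) (inj₂ refl) _ _ = refl
    equal (inj₁ refl) (inj₁ refl) _ u≢v _ = contradiction refl u≢v
    equal (inj₂ refl) (inj₂ refl) _ u≢v _ = contradiction refl u≢v
    equal (inj₁ refl) _ (inj₁ refl) _ w≢v = contradiction refl w≢v
    equal (inj₂ refl) _ (inj₂ refl) _ w≢v = contradiction refl w≢v

  module _ {S B : Subset (n G)} (ear : Ear S B) where

    open Ear ear

    with-ear : Subset (n G)
    with-ear = S ∪ fromList (start ∷ rest)

    ∈-ear⁻ : ∀ {w} → w ∈ with-ear → w ∈ S ⊎ w LM.∈ start ∷ rest
    ∈-ear⁻ = Sum.map₂ (∈-fromList⁻ (start ∷ rest)) ∘ x∈p∪q⁻ S _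

    ear⊆ : ∀ {w} → w LM.∈ start ∷ rest → w ∈ with-ear
    ear⊆ = q⊆p∪q S _ ∘ ∈-fromList⁺

    with-ear⊆ : S ⊆ B → with-ear ⊆ B
    with-ear⊆ S⊆B w∈ = [ S⊆B , proj₁ ∘ locate ]′ (∈-ear⁻ w∈)

    with-ear-nonseparable : NonSeparable G S → NonSeparable G with-ear
    with-ear-nonseparable ns =
      attach-ear ns root∈S end∈S root≢end root~start path (proj₂ ∘ locate)

  -- The ear joins the two ends of the edge, which closes it; `quiet` excludes chords at `root`.
  edge-ear⇒cycle : ∀ {a b B} → Adj G a b → (ear : Ear (pair a b) B) → InducedCycle (with-ear ear)
  edge-ear⇒cycle {a} {b} a~b ear =
    close-path path root∉ (∈∧∉⇒≢ end∈S start∉S ∘ sym) root~start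
      (adjacent (∈-pair⁻ root∈S) (∈-pair⁻ end∈S) root≢end) only
      (λ {w} → to , from)
    where
    open Ear ear

    root∉ : ¬ root LM.∈ start ∷ rest
    root∉ root∈ = [ root≢end , contradiction root∈S ]′ (proj₂ (locate root∈))

    adjacent : ∀ {u v} → u ≡ a ⊎ u ≡ b → v ≡ a ⊎ v ≡ b → u ≢ v → Adj G u v
    adjacent (inj₁ refl) (inj₁ refl) u≢v = contradiction refl u≢v
    adjacent (inj₂ refl) (inj₂ refl) u≢v = contradiction refl u≢v
    adjacent (inj₁ refl) (inj₂ refl) _ = a~b
    adjacent (inj₂ refl) (inj₁ refl) _ = Adj-sym a~b

    only : ∀ {w} → w LM.∈ rest → Adj G root w → w ≡ end
    only w∈ r~w = [ id , (λ w∉ → contradiction (quiet w∈ w∉ root∈S (Adj-sym r~w)) root≢end) ]′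
                    (proj₂ (locate (there w∈)))

    one-of : ∀ {u v w : V} → u ≡ a ⊎ u ≡ b → v ≡ a ⊎ v ≡ b → u ≢ v → w ≡ a ⊎ w ≡ b → w ≡ u ⊎ w ≡ v
    one-of (inj₁ refl) (inj₁ refl) u≢v _ = contradiction refl u≢v
    one-of (inj₂ refl) (inj₂ refl) u≢v _ = contradiction refl u≢v
    one-of (inj₁ refl) (inj₂ refl) _ w = w
    one-of (inj₂ refl) (inj₁ refl) _ w = swap w

    to : ∀ {w} → w ∈ with-ear ear → w ≡ root ⊎ w LM.∈ start ∷ rest
    to w∈ with ∈-ear⁻ ear w∈
    ... | inj₂ w∈π = inj₂ w∈π
    ... | inj₁ w∈S with one-of (∈-pair⁻ root∈S) (∈-pair⁻ end∈S) root≢end (∈-pair⁻ w∈S)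
    ... | inj₁ w≡  = inj₁ w≡
    ... | inj₂ refl = inj₂ (end∈ path)

    from : ∀ {w} → w ≡ root ⊎ w LM.∈ start ∷ rest → w ∈ with-ear ear
    from (inj₁ refl) = p⊆p∪q _ root∈S
    from (inj₂ w∈π)  = ear⊆ ear w∈π

-- Growing a nonseparable set inside a block.

module Growth (G : Digraph) (L : Fin (n G) → List ℕ) (X : Subset (n G))
  (uncolourable : ¬ Dicolourable G ⊤ L) (bound : ∀ x → x ∈ X → dmax G x ≤ ∣ L x ∣ₗ)
  (hole-at : ∀ {x} → x ∈ X → ∃ (Colouring.Hole G L x)) where

  open Walks G
  open Ears G
  open Cycles G
  open Pairs G
  open Colouring G L
  open Holes X uncolourable bound
  open Rotation G L X uncolourable bound hole-at

  module _ {B : Subset (n G)} (B⊆X : B ⊆ X) (nsB : NonSeparable G B) where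

    -- The only vertex of `U` outside `S` is `z`, so `spread` joins `z` to all of `S` in both
    -- directions, and `cone-complete` applies.
    cone : ∀ {S U z} → S ⊆ U → U ⊆ B → NonSeparable G S → NonSeparable G U → Full S →
      z ∈ U → z ∉ S → (∀ {w} → w ∈ U → w ≡ z ⊎ w ∈ S) → (∃ λ a → a ∈ S × Adj G a z) →
      ∀ d {x y} → x ∈ U → y ∈ U → x ≢ y → y ∈ N d x
    cone {S} {U} {z} S⊆U U⊆B nsS nsU full z∈U z∉S split (a , a∈ , a~z) = complete
      where
      apex : ∀ d {x} → x ∈ S → z ∈ N d x
      apex d x∈ with spread hole-at S⊆U (B⊆X ∘ U⊆B) nsS nsU full a∈ z∈U z∉S a~z d x∈
      ... | u , u∈N , u∈U , u∉S with split u∈U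
      ... | inj₁ refl = u∈N
      ... | inj₂ u∈S  = contradiction u∈S u∉S

      complete : ∀ d {x y} → x ∈ U → y ∈ U → x ≢ y → y ∈ N d x
      complete d x∈ y∈ x≢y with split x∈ | split y∈
      ... | inj₁ refl | inj₁ refl = contradiction refl x≢y
      ... | inj₂ x∈S  | inj₁ refl = apex d x∈S
      ... | inj₁ refl | inj₂ y∈S  =
        subst (λ e → _ ∈ N e z) (flip-flip d) (∈N-flip (flip d) (apex (flip d) y∈S))
      ... | inj₂ x∈S  | inj₂ y∈S  =
        cone-complete hole-at (B⊆X ∘ U⊆B ∘ S⊆U) nsS full (B⊆X (U⊆B z∈U)) z∉S apex d x∈S y∈S x≢y

    -- If `start` has a second neighbour in `S`, it forms an ear by itself and adding it to `S`
    -- gives a complete set, which is `B` or grows further. Otherwise only `root` and `end` have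
    -- neighbours on the ear outside `S`.
    grow : ∀ S → Acc _⊃_ S → NonSeparable G S → Full S → Large S → S ⊆ B →
      (∃ λ w → w ∈ B × w ∉ S) → IsCompleteSymmetric G B
    grow S (acc rec) nsS full large S⊆B (w , w∈ , w∉) =
      attach (FinP.any? λ x → (x ∈? S) ×-dec ¬? (x FinP.≟ root) ×-dec Adj? start x)
      where
      ear : Ear S B
      ear = let u , u∈ , _ = large w w
                v , v∈ , v≢u , _ = large u u
            in ear-exists nsB S⊆B u∈ v∈ (v≢u ∘ sym) w∈ w∉

      open Ear ear

      attach : Dec (∃ λ x → x ∈ S × x ≢ root × Adj G start x) → IsCompleteSymmetric G B
      attach (yes (x , x∈ , x≢root , start~x)) = finish (⊆-or-∉ B U)
        where
        U : Subset (n G)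
        U = S ∪ fromList (start ∷ x ∷ [])

        S⊆U : S ⊆ U
        S⊆U = p⊆p∪q _

        start∈U : start ∈ U
        start∈U = q⊆p∪q S _ (∈-fromList⁺ {xs = start ∷ x ∷ []} (here refl))

        split : ∀ {v} → v ∈ U → v ≡ start ⊎ v ∈ S
        split = ∈-∪-pair x∈

        U⊆B : U ⊆ B
        U⊆B v∈ = [ (λ where refl → proj₁ (locate (here refl))) , S⊆B ]′ (split v∈)

        nsU : NonSeparable G U
        nsU = attach-ear nsS root∈S x∈ (x≢root ∘ sym) root~start (cons start~x [] stop) λ where
          (here refl)         → inj₂ start∉S
          (there (here refl)) → inj₁ refl

        complete : ∀ d {u v} → u ∈ U → v ∈ U → u ≢ v → v ∈ N d u
        complete = cone S⊆U U⊆B nsS nsU full start∈U start∉S split (root , root∈S , root~start)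

        finish : B ⊆ U ⊎ (∃ λ v → v ∈ B × v ∉ U) → IsCompleteSymmetric G B
        finish (inj₁ B⊆U) u v u∈ v∈ u≢v = ∈N⁻ fwd (complete fwd (B⊆U u∈) (B⊆U v∈) u≢v)
        finish (inj₂ more) = grow U (rec (S⊆U , start , start∈U , start∉S)) nsU
          (λ d {u} u∈ → let t , t∈ , t≢u , _ = large u u in
             t , complete d u∈ (S⊆U t∈) (t≢u ∘ sym) , S⊆U t∈)
          (λ u v → let t , t∈ , t≢ = large u v in t , S⊆U t∈ , t≢) U⊆B more
      attach (no single) =
        -- A third vertex `t` of `S` exists, and `spread` demands a neighbour of it on the ear.
        let t , t∈ , t≢root , t≢end = large root end
            u , u∈N , u∈U , u∉S = spread hole-at (p⊆p∪q _) (B⊆X ∘ with-ear⊆ ear S⊆B) nsS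
              (with-ear-nonseparable ear nsS) full root∈S (ear⊆ ear (here refl)) start∉S root~start
              fwd t∈
        in contradiction (Adj-sym (N⇒Adj fwd u∈N)) (isolated t∈ t≢root t≢end (∈-ear⁻ ear u∈U) u∉S)
        where
        isolated : ∀ {t u} → t ∈ S → t ≢ root → t ≢ end → u ∈ S ⊎ u LM.∈ start ∷ rest → u ∉ S →
          ¬ Adj G u t
        isolated t∈ t≢root t≢end (inj₁ u∈S) u∉S _ = u∉S u∈S
        isolated t∈ t≢root t≢end (inj₂ (here refl)) u∉S u~t = single (_ , t∈ , t≢root , u~t)
        isolated t∈ t≢root t≢end (inj₂ (there u∈)) u∉S u~t = t≢end (quiet u∈ u∉S t∈ u~t)

    edge-block : ∀ {a b} → a ∈ B → b ∈ B → Adj G a b → B ⊆ pair a b → IsGallaiBlock G B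
    edge-block {a} {b} a∈ b∈ a~b B⊆ab with arc G a b in ab | arc G b a in ba
    ... | true  | true  = inj₂ (inj₂ (inj₂ λ u v u∈ v∈ → arc-between (∈-pair⁻ (B⊆ab u∈)) (∈-pair⁻ (B⊆ab v∈))))
      where
      arc-between : ∀ {u v} → u ≡ a ⊎ u ≡ b → v ≡ a ⊎ v ≡ b → u ≢ v → Arc G u v
      arc-between (inj₁ refl) (inj₁ refl) u≢v = contradiction refl u≢v
      arc-between (inj₂ refl) (inj₂ refl) u≢v = contradiction refl u≢v
      arc-between (inj₁ refl) (inj₂ refl) _ = ab
      arc-between (inj₂ refl) (inj₁ refl) _ = ba
    ... | true  | false = inj₁ (a , b , Adj-irrefl {a} {b} (inj₁ ab) ,
      (λ w → ∈-pair⁻ ∘ B⊆ab , λ where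
        (inj₁ refl) → a∈
        (inj₂ refl) → b∈) , ab , ba)
    ... | false | true  = inj₁ (b , a , Adj-irrefl {b} {a} (inj₁ ba) ,
      (λ w → swap ∘ ∈-pair⁻ ∘ B⊆ab , λ where
        (inj₁ refl) → b∈
        (inj₂ refl) → a∈) , ba , ab)
    edge-block a∈ b∈ (inj₁ ()) B⊆ab | false | false
    edge-block a∈ b∈ (inj₂ ()) B⊆ab | false | false

    large-block : ∀ {a b w} → a ∈ B → b ∈ B → Adj G a b → w ∈ B → w ∉ pair a b → IsGallaiBlock G B
    large-block {a} {b} {w} a∈ b∈ a~b w∈ w∉ = conclude (⊆-or-∉ B T)
      where
      ab⊆B : pair a b ⊆ B
      ab⊆B v∈ = [ (λ where refl → a∈) , (λ where refl → b∈) ]′ (∈-pair⁻ v∈)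

      ear : Ear (pair a b) B
      ear = ear-exists nsB ab⊆B ∈-pairˡ ∈-pairʳ (Adj-irrefl a~b) w∈ w∉

      open Ear ear

      T : Subset (n G)
      T = with-ear ear

      T⊆B : T ⊆ B
      T⊆B = with-ear⊆ ear ab⊆B

      nsT : NonSeparable G T
      nsT = with-ear-nonseparable ear (pair-nonseparable a~b)

      cycle : Full T × (IsDirectedCycle G T ⊎ IsSymmetricOddCycle G T)
      cycle = classify (B⊆X ∘ T⊆B) nsT 2≤m c enumerates consecutive chordless
        where open InducedCycle (edge-ear⇒cycle a~b ear)

      conclude : B ⊆ T ⊎ (∃ λ v → v ∈ B × v ∉ T) → IsGallaiBlock G B
      conclude (inj₁ B⊆T) = subst (IsGallaiBlock G) (⊆-antisym T⊆B B⊆T)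
        ([ inj₂ ∘ inj₁ , inj₂ ∘ inj₂ ∘ inj₁ ]′ (proj₂ cycle))
      conclude (inj₂ more) = inj₂ (inj₂ (inj₂
        (grow T (⊃-wellFounded T) nsT (proj₁ cycle)
          (three⇒large (p⊆p∪q _ root∈S) (p⊆p∪q _ end∈S) (ear⊆ ear (here refl))
            root≢end (∈∧∉⇒≢ root∈S start∉S) (∈∧∉⇒≢ end∈S start∉S))
          T⊆B more)))

    nonseparable⇒Gallai : Nonempty B → IsGallaiBlock G B
    nonseparable⇒Gallai (a , a∈) with ⊆-or-∉ B ⁅ a ⁆
    -- A single vertex is complete symmetric, vacuously.
    ... | inj₁ B⊆a = inj₂ (inj₂ (inj₂ λ u v u∈ v∈ u≢v → contradiction
            (trans (x∈⁅y⁆⇒x≡y a (B⊆a u∈)) (sym (x∈⁅y⁆⇒x≡y a (B⊆a v∈)))) u≢v))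
    ... | inj₂ (w , w∈ , w∉a)
      with first-step (∈∧∉⇒≢ (x∈⁅x⁆ a) w∉a) (proj₁ nsB a w a∈ w∈)
    ... | b , b∈ , a~b with ⊆-or-∉ B (pair a b)
    ... | inj₁ B⊆ab           = edge-block a∈ b∈ a~b B⊆ab
    ... | inj₂ (v , v∈ , v∉) = large-block a∈ b∈ a~b v∈ v∉

theorem7p3 : (G : Digraph) (X : Subset (n G)) (L : Fin (n G) → List ℕ) →
    Connected G ⊤ → Connected G X →
    Dicolourable G (∁ X) L → ¬ Dicolourable G ⊤ L →
    (∀ x → x ∈ X → dmax G x ≤ ∣ L x ∣ₗ) →
    DirectedGallaiForest G X
theorem7p3 G X L _ connX colourable uncolourable bound C (C⊆X , nonempty , connC , _) =
  nonempty , connC , λ B (B⊆C , B≢∅ , ns , _) →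
    nonseparable⇒Gallai (C⊆X ∘ B⊆C) ns B≢∅
  where
  open Growth G L X uncolourable bound
    (Colouring.Holes.hole-exists G L X uncolourable bound connX colourable)
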